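{- There exist absolute constants $c>0$ and $c'>0$ such that for every prime $q$ there exists a minimal blocking set in $\mathrm{PG}(2,q)$ of size at least $c'\,q^{1+c}$; that is, $B(2,q)\ge c'\,q^{1+c}$.
   Context: $\mathrm{PG}(2,q)$ is the projective plane over $\mathbb{F}_q$. A set of points $B\subset\mathrm{PG}(2,q)$ is a blocking set if $\ell\cap B\ne\emptyset$ for every line $\ell$ of $\mathrm{PG}(2,q)$; it is a minimal blocking set if it is a blocking set and no proper subset of $B$ is a blocking set. $B(2,q)$ denotes the maximum cardinality of a minimal blocking set in $\mathrm{PG}(2,q)$. -}

module Defs where

open import Data.Nat.Base as ℕ using (ℕ)
open import Data.Nat.DivMod using (_mod_)
open import Data.Nat.Primality using (Prime; prime⇒nonZero)
open import Data.Integer.Base using (∣_∣)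
open import Data.Rational.Base using (ℚ; ↥_; ↧ₙ_)
open import Data.Fin.Base using (Fin; toℕ)
open import Data.Vec.Base using (Vec; []; _∷_; map; replicate)
open import Data.List.Base using (List; length)
open import Data.List.Relation.Unary.Any using (Any)
open import Data.Product.Base using (Σ; ∃; _×_; proj₁)
open import Relation.Binary.Bundles using (Setoid)
open import Relation.Binary.PropositionalEquality.Core using (_≡_; _≢_)
open import Relation.Nullary.Negation.Core using (¬_)
open import Relation.Unary using (Pred)
import Relation.Unary.Relation.Binary.Equality as Pred
import Relation.Binary.Construct.On as On
import Data.List.Relation.Unary.Unique.Setoid as UniqueSetoid
import Data.List.Relation.Binary.Subset.Setoid as SubsetSetoid
open import Level using (0ℓ)

infix 4 _≥_·_^1+_

-- For positive c = a / b and κ = s / t this is n ≥ κ q^(1+c): multiply by t and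
-- raise to the b-th power, using b (1 + c) = b + a.  ∣_∣ only turns the
-- numerators into naturals, so the reading is valid for nonnegative κ and c only.
_≥_·_^1+_ : ℕ → ℚ → ℕ → ℚ → Set
n ≥ κ · q ^1+ c =
  ∣ ↥ κ ∣ ℕ.^ ↧ₙ c ℕ.* q ℕ.^ (↧ₙ c ℕ.+ ∣ ↥ c ∣) ℕ.≤ (↧ₙ κ ℕ.* n) ℕ.^ ↧ₙ c

module PG2 (q : ℕ) (q-prime : Prime q) where

  private instance
    q-nonZero : ℕ.NonZero q
    q-nonZero = prime⇒nonZero q-prime

  -- The prime field of order q, as residues modulo q.
  𝔽 : Set
  𝔽 = Fin q

  infixl 6 _+_
  infixl 7 _*_

  0# : 𝔽
  0# = 0 mod q

  _+_ _*_ : 𝔽 → 𝔽 → 𝔽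
  x + y = (toℕ x ℕ.+ toℕ y) mod q
  x * y = (toℕ x ℕ.* toℕ y) mod q

  NonzeroVector : Set
  NonzeroVector = Σ (Vec 𝔽 3) (_≢ replicate 3 0#)

  span : NonzeroVector → Pred (Vec 𝔽 3) 0ℓ
  span v w = ∃ λ (k : 𝔽) → w ≡ map (k *_) (proj₁ v)

  -- A point is a one-dimensional subspace of 𝔽³, given by a spanning vector;
  -- two points are equal when the subspaces coincide.
  points : Setoid 0ℓ 0ℓ
  points = On.setoid (Pred.≐-setoid (Vec 𝔽 3) 0ℓ) span

  Point : Set
  Point = Setoid.Carrier points

  -- A line is given by the coefficients of its equation.  Proportional
  -- coefficients name the same line, which is harmless since lines are only
  -- quantified over and never compared or counted.
  Line : Set
  Line = NonzeroVector

  dot : Vec 𝔽 3 → Vec 𝔽 3 → 𝔽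
  dot (x₀ ∷ x₁ ∷ x₂ ∷ []) (a₀ ∷ a₁ ∷ a₂ ∷ []) = x₀ * a₀ + x₁ * a₁ + x₂ * a₂

  infix 4 _on_
  _on_ : Point → Line → Set
  x on ℓ = dot (proj₁ x) (proj₁ ℓ) ≡ 0#

  open UniqueSetoid points using (Unique)
  open SubsetSetoid points using (_⊆_)

  -- No two entries of the list are equal as points, so its length is the
  -- cardinality of the set.
  record PointSet : Set where
    constructor pointSet
    field
      elements : List Point
      unique   : Unique elements

    size : ℕ
    size = length elements

  open PointSet public

  Blocking : PointSet → Set
  Blocking B = ∀ (ℓ : Line) → Any (_on ℓ) (elements B)

  infix 4 _⊊_
  _⊊_ : PointSet → PointSet → Set
  A ⊊ B = (elements A ⊆ elements B) × ¬ (elements B ⊆ elements A)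

  MinimalBlocking : PointSet → Set
  MinimalBlocking B = Blocking B × (∀ A → A ⊊ B → ¬ Blocking A)

  -- "b = B(2,q)": b is the maximum size of a minimal blocking set.
  IsB : ℕ → Set
  IsB b = (∃ λ B → MinimalBlocking B × size B ≡ b)
        × (∀ B → MinimalBlocking B → size B ℕ.≤ b)

{-# OPTIONS --safe #-}

-- Let A = [0, 17^h) and let S consist of the integers in [0, 289^h) whose base 17 digits in
-- even positions are 0 or 3, where 3·289^h ≤ q; note that ±3 are non-squares mod 17.  Attach to
-- (a , s) ∈ A × S the point (a, a² + s) and the line y = 2ax − a² + s.  The point of (a , s)
-- lies on the line of (b , t) iff s + (a − b)² = t, and looking at the lowest digit in which
-- a and b differ shows that this forces a = b (Ruzsa).  So these flags form an induced matching
-- of size 17^h · 34^h, a positive power of q times q.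
--
-- Let B be the set of all points which lie on no flag line, except possibly their own.  Then B
-- meets every line: if the slope is not of the form 2a, at infinity, and otherwise because the
-- coordinate x of an affine point of B on the line can be chosen digit by digit, by a finite
-- check mod 17.  Each flag line meets B in its own flag point only, hence every blocking set
-- contained in B contains all flag points.
module Submission where

open import Defs
open import Data.Nat.Base using (ℕ)
open import Data.Nat.Primality using (Prime)
open import Data.Rational.Base using (ℚ; 0ℚ; _<_)
open import Data.Product.Base using (∃; _×_)

open import Algebra.Bundles using (AbelianGroup)
open import Data.Nat.Base as ℕ using (zero; suc; NonZero)
import Data.Nat.Properties as ℕ
open import Data.Nat.Coprimality using (prime⇒coprime; coprime-Bézout)
open import Data.Nat.DivMod using (_%_; _mod_; _divMod_; result; [m+kn]%n≡m%n; m<n⇒m%n≡m; m%n<n)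
open import Data.Nat.GCD using (module Bézout)
open import Data.Nat.Primality using (prime⇒nonZero; prime⇒nonTrivial)
open import Data.Integer.Base using (ℤ; +_; -[1+_]; _+_; _*_; _-_; -_; ∣_∣)
import Data.Integer.Properties as ℤ
import Data.Integer.DivMod as ℤ
open import Data.Integer.Divisibility.Signed using (_∣_; divides; ∣m∣n⇒∣m+n; ∣n⇒∣m*n; ∣m⇒∣m*n; ∣m⇒∣-m)
open import Data.Integer.Tactic.RingSolver using (solve-∀)
import Data.Rational.Base as ℚ
import Data.Rational.Properties as ℚ
open import Data.Fin.Base using (Fin; toℕ; zero; suc; fromℕ<)
open import Data.Fin.Properties using (all?; any?; _≟_; toℕ<n; toℕ-injective; toℕ-fromℕ<; ¬∀⟶∃¬)
open import Data.List.Base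
  using (List; []; _∷_; _++_; length; map; filter; deduplicate; allFin; upTo; cartesianProduct; cartesianProductWith)
open import Data.List.Properties using (filter-notAll; length-++; length-map; length-upTo)
open import Data.List.Membership.Propositional using (_∈_; find; lose)
open import Data.List.Membership.Propositional.Properties
import Data.List.Membership.Setoid as SetoidMembership
import Data.List.Membership.Setoid.Properties as SetoidMembership
open import Data.List.Relation.Unary.All as All using (All; []; _∷_)
open import Data.List.Relation.Unary.AllPairs using ([]; _∷_)
open import Data.List.Relation.Unary.Any as Any using (Any; here; there)
import Data.List.Relation.Unary.Any.Properties as Any
open import Data.List.Relation.Unary.Unique.DecPropositional.Properties using (deduplicate-!)
open import Data.List.Relation.Unary.Unique.Propositional using (Unique)
open import Data.List.Relation.Unary.Unique.Propositional.Properties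
  using (filter⁺; cartesianProductWith⁺; cartesianProduct⁺; upTo⁺; allFin⁺)
import Data.List.Relation.Unary.Unique.Setoid as UniqueSetoid
import Data.List.Relation.Unary.Unique.Setoid.Properties as UniquePropertiesSetoid
open import Data.Product.Base using (_,_; proj₁; proj₂)
open import Data.Sum.Base using (_⊎_; inj₁; inj₂; [_,_]′)
open import Data.Unit.Base using (⊤; tt)
open import Data.Vec.Base as Vec using (Vec; []; _∷_; replicate)
open import Data.Vec.Properties using (∷-injective; ≡-dec)
open import Function.Base using (id; _∘_)
open import Relation.Binary.Bundles using (Setoid)
open import Relation.Binary.Definitions using (DecidableEquality)
open import Relation.Binary.PropositionalEquality
open import Relation.Nullary using (¬_; Dec; yes; no; ¬?; contradiction)
open import Relation.Nullary.Decidable using (from-yes; decidable-stable; map′; _→-dec_; _×-dec_; _⊎-dec_)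

open import Algebra.Properties.Group (AbelianGroup.group ℤ.+-0-abelianGroup)
  using () renaming (∙-cancelˡ to +-cancelˡ)

-- Congruence of integers and its return to equality in ℕ.

infix 4 _≈_[mod_]
record _≈_[mod_] (a b : ℤ) (n : ℕ) : Set where
  constructor congruent
  field difference : + n ∣ a - b

open _≈_[mod_] public

private
  %-cong₊ : ∀ {m k n} .{{_ : NonZero n}} j → + m - + k ≡ + j * + n → m % n ≡ k % n
  %-cong₊ {m} {k} {n} j eq = trans (cong (_% n) (ℤ.+-injective (begin
    + m                  ≡⟨ lem (+ m) (+ k) ⟩
    + k + (+ m - + k)    ≡⟨ cong (_+_ (+ k)) eq ⟩
    + k + + j * + n      ≡⟨ cong (_+_ (+ k)) (ℤ.pos-* j n) ⟨
    + (k ℕ.+ j ℕ.* n)    ∎))) ([m+kn]%n≡m%n k j n)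
    where
    open ≡-Reasoning
    lem : ∀ x y → x ≡ y + (x - y)
    lem = solve-∀

≈⇒%≡ : ∀ m k {n} .{{_ : NonZero n}} → + m ≈ + k [mod n ] → m % n ≡ k % n
≈⇒%≡ m k (congruent (divides (+ j) eq)) = %-cong₊ {m} {k} j eq
≈⇒%≡ m k {n} (congruent (divides -[1+ j ] eq)) = sym (%-cong₊ {k} {m} (suc j) (begin
  + k - + m          ≡⟨ lem (+ k) (+ m) ⟩
  - (+ m - + k)      ≡⟨ cong -_ eq ⟩
  - (-[1+ j ] * + n) ≡⟨ ℤ.neg-distribˡ-* -[1+ j ] (+ n) ⟩
  + suc j * + n      ∎))
  where
  open ≡-Reasoning
  lem : ∀ x y → x - y ≡ - (y - x)
  lem = solve-∀

-- The only way back from congruences to equations: later steps bound both sides by the modulus and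
-- then compare naturals.
≈⇒≡ : ∀ {m k n} → m ℕ.< n → k ℕ.< n → + m ≈ + k [mod n ] → m ≡ k
≈⇒≡ {m} {k} {n@(suc _)} m<n k<n m≈k = begin
  m     ≡⟨ m<n⇒m%n≡m m<n ⟨
  m % n ≡⟨ ≈⇒%≡ m k m≈k ⟩
  k % n ≡⟨ m<n⇒m%n≡m k<n ⟩
  k     ∎
  where open ≡-Reasoning

⟦_⟧ : ∀ {n} → Fin n → ℤ
⟦ i ⟧ = + toℕ i

⟦⟧-injective : ∀ {n} {i j : Fin n} → ⟦ i ⟧ ≈ ⟦ j ⟧ [mod n ] → i ≡ j
⟦⟧-injective {i = i} {j} i≈j = toℕ-injective (≈⇒≡ (toℕ<n i) (toℕ<n j) i≈j)

-- Base 17 digits and the finite checks modulo 17.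

sq : ℤ → ℤ
sq x = x * x

digits-injective : ∀ {e e′ : Fin 17} {u v} → ⟦ e ⟧ + + 17 * u ≡ ⟦ e′ ⟧ + + 17 * v → e ≡ e′ × u ≡ v
digits-injective {e} {e′} {u} {v} eq with ⟦⟧-injective {i = e} {e′} (congruent (divides (v - u) (begin
  ⟦ e ⟧ - ⟦ e′ ⟧                                          ≡⟨ lem ⟦ e ⟧ ⟦ e′ ⟧ u v ⟩
  ⟦ e ⟧ + + 17 * u - (⟦ e′ ⟧ + + 17 * v) + (v - u) * + 17 ≡⟨ cong (_+ (v - u) * + 17) (ℤ.i≡j⇒i-j≡0 eq) ⟩
  + 0 + (v - u) * + 17                                    ≡⟨ ℤ.+-identityˡ _ ⟩
  (v - u) * + 17                                          ∎)))
  where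
  open ≡-Reasoning
  lem : ∀ e e′ u v → e - e′ ≡ e + + 17 * u - (e′ + + 17 * v) + (v - u) * + 17
  lem = solve-∀
... | refl = refl , ℤ.*-cancelˡ-≡ (+ 17) u v (+-cancelˡ ⟦ e ⟧ _ _ eq)

ρ : Fin 2 → Fin 17
ρ zero    = zero
ρ (suc _) = suc (suc (suc zero))

ρ-injective : ∀ {i j} → ρ i ≡ ρ j → i ≡ j
ρ-injective {zero}     {zero}     eq = refl
ρ-injective {suc zero} {suc zero} eq = refl

-- d + (x − a)² ≡ d′ + (x′ − a′)² mod 17, with −1 replaced by 16 to stay in ℕ.
Close : (d x a d′ x′ a′ : Fin 17) → Set
Close d x a d′ x′ a′ =
  (toℕ d ℕ.+ (toℕ x ℕ.+ 16 ℕ.* toℕ a) ℕ.* (toℕ x ℕ.+ 16 ℕ.* toℕ a)) % 17 ≡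
  (toℕ d′ ℕ.+ (toℕ x′ ℕ.+ 16 ℕ.* toℕ a′) ℕ.* (toℕ x′ ℕ.+ 16 ℕ.* toℕ a′)) % 17

close? : ∀ d x a d′ x′ a′ → Dec (Close d x a d′ x′ a′)
close? d x a d′ x′ a′ = _ ℕ.≟ _

-- All three equalities are demanded, not just `x ≡ b`, because `meets-tail` needs them to pass to
-- the higher digits.
Avoids : Fin 17 → Fin 17 → Fin 17 → Set
Avoids d a x = ∀ (b : Fin 17) (i : Fin 2) → Close d x b (ρ i) x a → x ≡ a × x ≡ b × d ≡ ρ i

avoids? : ∀ d a x → Dec (Avoids d a x)
avoids? d a x = all? λ b → all? λ i → close? d x b (ρ i) x a →-dec (x ≟ a ×-dec x ≟ b ×-dec d ≟ ρ i)

abstract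
  -- If d is 0 or 3, then x = a works: (a - b)² would be 0 or ±3, and ±3 are non-squares. Otherwise
  -- some square y has y - d and y - d + 3 both non-squares (y - d is 3, 7 or 11), and (x - a)² = y
  -- leaves no b at all.
  avoiding-residue : ∀ d a → ∃ (Avoids d a)
  avoiding-residue = from-yes (all? {n = 17} λ d → all? {n = 17} λ a → any? (avoids? d a))

  -- The hypothesis makes (a - b)² congruent to a difference of allowed digits, so to 0 or ±3, and
  -- only 0 is a square.
  residue-rigid : ∀ i j a b → Close (ρ i) a b (ρ j) a a → a ≡ b × ρ i ≡ ρ j
  residue-rigid = from-yes (all? {n = 2} λ i → all? {n = 2} λ j → all? {n = 17} λ a → all? {n = 17} λ b →
    close? (ρ i) a b (ρ j) a a →-dec (a ≟ b ×-dec ρ i ≟ ρ j))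

-- Says that the point with abscissa x of the line y = 2ax − a² + d lies on y = 2bx − b² + s.
Meets : (d x b s a : ℤ) → Set
Meets d x b s a = d + sq (x - b) ≡ s + sq (x - a)

-- One digit is split off the abscissas but two off d and s: a common lowest digit makes the squares
-- multiples of 289, so they first matter two positions up.
module _ (δ e r e′ : Fin 17) (x₀ a₀ b₀ : Fin 17) (d s x a b : ℤ) where

  private
    Meets′ : Set
    Meets′ = Meets (⟦ δ ⟧ + + 17 * (⟦ e ⟧ + + 17 * d)) (⟦ x₀ ⟧ + + 17 * x) (⟦ b₀ ⟧ + + 17 * b)
                   (⟦ r ⟧ + + 17 * (⟦ e′ ⟧ + + 17 * s)) (⟦ a₀ ⟧ + + 17 * a)

  meets⇒close : Meets′ → Close δ x₀ b₀ r x₀ a₀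
  meets⇒close eq = ≈⇒%≡ l r′ (congruent (divides (K - K′) (begin
    + l - + r′
      ≡⟨ cong₂ _-_ (cast δ x₀ b₀) (cast r x₀ a₀) ⟩
    ⟦ δ ⟧ + sq (⟦ x₀ ⟧ + + 16 * ⟦ b₀ ⟧) - (⟦ r ⟧ + sq (⟦ x₀ ⟧ + + 16 * ⟦ a₀ ⟧))
      ≡⟨ cong₂ (λ t t′ → t - t′) (lem ⟦ δ ⟧ ⟦ e ⟧ ⟦ x₀ ⟧ ⟦ b₀ ⟧ d x b) (lem ⟦ r ⟧ ⟦ e′ ⟧ ⟦ x₀ ⟧ ⟦ a₀ ⟧ s x a) ⟩
    L + K * + 17 - (R + K′ * + 17)
      ≡⟨ lem₂ L R K K′ (+ 17) ⟩
    (L - R) + (K - K′) * + 17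
      ≡⟨ cong (_+ (K - K′) * + 17) (ℤ.i≡j⇒i-j≡0 eq) ⟩
    + 0 + (K - K′) * + 17
      ≡⟨ ℤ.+-identityˡ _ ⟩
    (K - K′) * + 17 ∎)))
    where
    open ≡-Reasoning
    l r′ : ℕ
    l  = toℕ δ ℕ.+ (toℕ x₀ ℕ.+ 16 ℕ.* toℕ b₀) ℕ.* (toℕ x₀ ℕ.+ 16 ℕ.* toℕ b₀)
    r′ = toℕ r ℕ.+ (toℕ x₀ ℕ.+ 16 ℕ.* toℕ a₀) ℕ.* (toℕ x₀ ℕ.+ 16 ℕ.* toℕ a₀)
    L R K K′ : ℤ
    L = ⟦ δ ⟧ + + 17 * (⟦ e ⟧ + + 17 * d) + sq (⟦ x₀ ⟧ + + 17 * x - (⟦ b₀ ⟧ + + 17 * b))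
    R = ⟦ r ⟧ + + 17 * (⟦ e′ ⟧ + + 17 * s) + sq (⟦ x₀ ⟧ + + 17 * x - (⟦ a₀ ⟧ + + 17 * a))
    -- The quotients by 17. The product comes from factoring the difference of the squares of x₀ +
    -- 16b₀ and x₀ + 17x - (b₀ + 17b); the subtracted term accounts for the higher digits.
    K  = (⟦ b₀ ⟧ - (x - b)) * (+ 2 * ⟦ x₀ ⟧ + + 15 * ⟦ b₀ ⟧ + + 17 * (x - b)) - (⟦ e ⟧ + + 17 * d)
    K′ = (⟦ a₀ ⟧ - (x - a)) * (+ 2 * ⟦ x₀ ⟧ + + 15 * ⟦ a₀ ⟧ + + 17 * (x - a)) - (⟦ e′ ⟧ + + 17 * s)
    cast : ∀ (c y z : Fin 17) →
      + (toℕ c ℕ.+ (toℕ y ℕ.+ 16 ℕ.* toℕ z) ℕ.* (toℕ y ℕ.+ 16 ℕ.* toℕ z)) ≡ ⟦ c ⟧ + sq (⟦ y ⟧ + + 16 * ⟦ z ⟧)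
    cast c y z = cong (_+_ ⟦ c ⟧) (trans (ℤ.pos-* y+16z y+16z) (cong (λ t → sq (⟦ y ⟧ + t)) (ℤ.pos-* 16 (toℕ z))))
      where y+16z = toℕ y ℕ.+ 16 ℕ.* toℕ z
    lem : ∀ δ e x₀ b₀ d x b → δ + (x₀ + + 16 * b₀) * (x₀ + + 16 * b₀) ≡
      δ + + 17 * (e + + 17 * d) + (x₀ + + 17 * x - (b₀ + + 17 * b)) * (x₀ + + 17 * x - (b₀ + + 17 * b)) +
      ((b₀ - (x - b)) * (+ 2 * x₀ + + 15 * b₀ + + 17 * (x - b)) - (e + + 17 * d)) * + 17
    lem = solve-∀
    lem₂ : ∀ L R K K′ n → L + K * n - (R + K′ * n) ≡ (L - R) + (K - K′) * n
    lem₂ = solve-∀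

  -- Once the lowest digits agree, both sides have the form δ + 17(e + 289-free tail), where the
  -- tail has absorbed its square as d + (x - b)². Cancelling two digits leaves the same equation
  -- for the tails.
  meets-tail : x₀ ≡ a₀ → x₀ ≡ b₀ → δ ≡ r → Meets′ → Meets d x b s a
  meets-tail refl refl refl eq = proj₂ (digits-injective {e} {e′} (ℤ.*-cancelˡ-≡ (+ 17) _ _ (+-cancelˡ ⟦ δ ⟧ _ _ (begin
    ⟦ δ ⟧ + + 17 * (⟦ e ⟧ + + 17 * (d + sq (x - b)))  ≡⟨ lem ⟦ δ ⟧ ⟦ e ⟧ ⟦ x₀ ⟧ d x b ⟨
    ⟦ δ ⟧ + + 17 * (⟦ e ⟧ + + 17 * d) + sq (⟦ x₀ ⟧ + + 17 * x - (⟦ x₀ ⟧ + + 17 * b)) ≡⟨ eq ⟩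
    ⟦ δ ⟧ + + 17 * (⟦ e′ ⟧ + + 17 * s) + sq (⟦ x₀ ⟧ + + 17 * x - (⟦ x₀ ⟧ + + 17 * a)) ≡⟨ lem ⟦ δ ⟧ ⟦ e′ ⟧ ⟦ x₀ ⟧ s x a ⟩
    ⟦ δ ⟧ + + 17 * (⟦ e′ ⟧ + + 17 * (s + sq (x - a))) ∎))))
    where
    open ≡-Reasoning
    lem : ∀ δ e x₀ d x b →
      δ + + 17 * (e + + 17 * d) + (x₀ + + 17 * x - (x₀ + + 17 * b)) * (x₀ + + 17 * x - (x₀ + + 17 * b)) ≡
      δ + + 17 * (e + + 17 * (d + (x - b) * (x - b)))
    lem = solve-∀

-- Only the lowest 2h digits matter, so negative integers and integers beyond 289^h can be good.
Good : ℕ → ℤ → Set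
Good zero    d = ⊤
Good (suc h) d = ∃ λ (i : Fin 2) → ∃ λ (e : Fin 17) → ∃ λ d′ →
  d ≡ ⟦ ρ i ⟧ + + 17 * (⟦ e ⟧ + + 17 * d′) × Good h d′

-- Splitting off digits, and induction on their number.

splitℤ : ∀ d → ∃ λ (δ : Fin 17) → ∃ λ d′ → d ≡ ⟦ δ ⟧ + + 17 * d′
-- Floor division gives negative integers a digit too; `avoiding-abscissa` is later applied to
-- `+ D - + N`, which may be negative.
splitℤ d = fromℕ< (ℤ.n%ℕd<d d 17) , d ℤ./ℕ 17 , (begin
  d                                  ≡⟨ ℤ.a≡a%ℕn+[a/ℕn]*n d 17 ⟩
  + (d ℤ.%ℕ 17) + (d ℤ./ℕ 17) * + 17 ≡⟨ cong₂ _+_ (cong +_ (sym (toℕ-fromℕ< (ℤ.n%ℕd<d d 17)))) (ℤ.*-comm (d ℤ./ℕ 17) (+ 17)) ⟩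
  _                                  ∎)
  where open ≡-Reasoning

join : Fin 17 → ℕ → ℕ
join α a = toℕ α ℕ.+ 17 ℕ.* a

splitℕ : ∀ h {a} → a ℕ.< 17 ℕ.^ suc h → ∃ λ (α : Fin 17) → ∃ λ a′ → a ≡ join α a′ × a′ ℕ.< 17 ℕ.^ h
splitℕ h {a} a< with a divMod 17
... | result a′ α refl = α , a′ , cong (toℕ α ℕ.+_) (ℕ.*-comm a′ 17) ,
  ℕ.*-cancelˡ-< 17 _ _ (ℕ.≤-<-trans (ℕ.≤-trans (ℕ.≤-reflexive (ℕ.*-comm 17 a′)) (ℕ.m≤n+m _ (toℕ α))) a<)

join-< : ∀ {n} (α : Fin 17) {a} → a ℕ.< n → join α a ℕ.< 17 ℕ.* n
join-< {n} α {a} a<n = ℕ.<-≤-trans (ℕ.+-monoˡ-< (17 ℕ.* a) (toℕ<n α))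
  (ℕ.≤-trans (ℕ.≤-reflexive (sym (ℕ.*-suc 17 a))) (ℕ.*-monoʳ-≤ 17 a<n))

pos-join : ∀ (α : Fin 17) a → + join α a ≡ ⟦ α ⟧ + + 17 * + a
pos-join α a = cong (_+_ ⟦ α ⟧) (ℤ.pos-* 17 a)

meets-cong : ∀ d {x x′ b b′ s s′ a a′} → x ≡ x′ → b ≡ b′ → s ≡ s′ → a ≡ a′ → Meets d x b s a → Meets d x′ b′ s′ a′
meets-cong d refl refl refl refl eq = eq

-- The digits of x are chosen independently: if the point meets the line of (b , s), then x, a and
-- b agree in the lowest digit, so both squares only contribute to the higher digits.
avoiding-abscissa : ∀ h d {a} → a ℕ.< 17 ℕ.^ h → ∃ λ x → x ℕ.< 17 ℕ.^ h ×
  (∀ b s → b ℕ.< 17 ℕ.^ h → Good h s → Meets d (+ x) (+ b) s (+ a) → x ≡ b)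
-- Only 0 lies below 17^0, so x and b coincide.
avoiding-abscissa zero    d a< = 0 , ℕ.≤-refl , λ b s b< _ _ → sym (ℕ.n<1⇒n≡0 b<)
avoiding-abscissa (suc h) d a< with splitℤ d | splitℕ h a<
... | δ , D , refl | a₀ , a₁ , refl , a₁< with splitℤ D | avoiding-residue δ a₀
... | e , d′ , refl | x₀ , x₀-avoids with avoiding-abscissa h d′ a₁<
... | x₁ , x₁< , x₁-avoids = join x₀ x₁ , join-< x₀ x₁< , unique
  where
  unique : ∀ b s → b ℕ.< 17 ℕ.^ suc h → Good (suc h) s →
    Meets (⟦ δ ⟧ + + 17 * (⟦ e ⟧ + + 17 * d′)) (+ (join x₀ x₁)) (+ b) s (+ (join a₀ a₁)) →
    join x₀ x₁ ≡ b
  unique b s b< (i , e′ , s′ , s≡ , s′-good) eq with splitℕ h b<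
  ... | b₀ , b₁ , b≡ , b₁< = trans (cong₂ join x₀≡b₀ x₁≡b₁) (sym b≡)
    where
    eq′ : Meets (⟦ δ ⟧ + + 17 * (⟦ e ⟧ + + 17 * d′)) (⟦ x₀ ⟧ + + 17 * + x₁) (⟦ b₀ ⟧ + + 17 * + b₁)
                (⟦ ρ i ⟧ + + 17 * (⟦ e′ ⟧ + + 17 * s′)) (⟦ a₀ ⟧ + + 17 * + a₁)
    eq′ = meets-cong (⟦ δ ⟧ + + 17 * (⟦ e ⟧ + + 17 * d′)) (pos-join x₀ x₁) (trans (cong +_ b≡) (pos-join b₀ b₁)) s≡ (pos-join a₀ a₁) eq
    digits : x₀ ≡ a₀ × x₀ ≡ b₀ × δ ≡ ρ i
    digits = x₀-avoids b₀ i (meets⇒close δ e (ρ i) e′ x₀ a₀ b₀ d′ s′ (+ x₁) (+ a₁) (+ b₁) eq′)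
    x₀≡b₀ = proj₁ (proj₂ digits)
    x₁≡b₁ : x₁ ≡ b₁
    x₁≡b₁ = x₁-avoids b₁ s′ b₁< s′-good
      (meets-tail δ e (ρ i) e′ x₀ a₀ b₀ d′ s′ (+ x₁) (+ a₁) (+ b₁) (proj₁ digits) x₀≡b₀ (proj₂ (proj₂ digits)) eq′)

-- The equation reads s + (a - b)² = s′. The lowest digits of a and b agree by `residue-rigid`, and
-- `meets-tail` hands the rest to the induction hypothesis.
good-rigid : ∀ h {a b s s′} → a ℕ.< 17 ℕ.^ h → b ℕ.< 17 ℕ.^ h → Good h s → Good h s′ →
  Meets s (+ a) (+ b) s′ (+ a) → a ≡ b
good-rigid zero a< b< _ _ _ = trans (ℕ.n<1⇒n≡0 a<) (sym (ℕ.n<1⇒n≡0 b<))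
good-rigid (suc h) {a} {b} {s} {s′} a< b< (i , e , t , s≡ , t-good) (j , e′ , t′ , s′≡ , t′-good) eq
  with splitℕ h a< | splitℕ h b<
... | a₀ , a₁ , a≡ , a₁< | b₀ , b₁ , b≡ , b₁< =
  trans a≡ (trans (cong₂ join (proj₁ digits) a₁≡b₁) (sym b≡))
  where
  a≡′ : + a ≡ ⟦ a₀ ⟧ + + 17 * + a₁
  a≡′ = trans (cong +_ a≡) (pos-join a₀ a₁)
  eq′ : Meets (⟦ ρ i ⟧ + + 17 * (⟦ e ⟧ + + 17 * t)) (⟦ a₀ ⟧ + + 17 * + a₁) (⟦ b₀ ⟧ + + 17 * + b₁)
              (⟦ ρ j ⟧ + + 17 * (⟦ e′ ⟧ + + 17 * t′)) (⟦ a₀ ⟧ + + 17 * + a₁)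
  eq′ = meets-cong (⟦ ρ i ⟧ + + 17 * (⟦ e ⟧ + + 17 * t)) a≡′ (trans (cong +_ b≡) (pos-join b₀ b₁)) s′≡ a≡′
    (subst (λ u → Meets u (+ a) (+ b) s′ (+ a)) s≡ eq)
  digits : a₀ ≡ b₀ × ρ i ≡ ρ j
  digits = residue-rigid i j a₀ b₀ (meets⇒close (ρ i) e (ρ j) e′ a₀ a₀ b₀ t t′ (+ a₁) (+ a₁) (+ b₁) eq′)
  a₁≡b₁ : a₁ ≡ b₁
  a₁≡b₁ = good-rigid h a₁< b₁< t-good t′-good
    (meets-tail (ρ i) e (ρ j) e′ a₀ a₀ b₀ t t′ (+ a₁) (+ a₁) (+ b₁) refl (proj₁ digits) (proj₂ digits) eq′)

-- The flags and their number.

join-injective : ∀ {α β a b} → join α a ≡ join β b → α ≡ β × a ≡ b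
join-injective {α} {β} {a} {b} eq =
  let α≡β , a≡b = digits-injective (trans (sym (pos-join α a)) (trans (cong +_ eq) (pos-join β b)))
  in α≡β , ℤ.+-injective a≡b

goods : ℕ → List ℕ
goods zero    = 0 ∷ []
goods (suc h) = cartesianProductWith (λ i → join (ρ i)) (allFin 2)
  (cartesianProductWith join (allFin 17) (goods h))

goods-good : ∀ h {s} → s ∈ goods h → Good h (+ s) × s ℕ.< 289 ℕ.^ h
goods-good zero    (here refl) = tt , ℕ.≤-refl
goods-good (suc h) s∈ with ∈-cartesianProductWith⁻ (λ i → join (ρ i)) (allFin 2) (cartesianProductWith join (allFin 17) (goods h)) s∈
... | i , D , _ , D∈ , refl with ∈-cartesianProductWith⁻ join (allFin 17) (goods h) D∈
... | e , s , _ , s∈ , refl with goods-good h s∈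
... | s-good , s< = (i , e , + s , trans (pos-join (ρ i) (join e s)) (cong (λ t → ⟦ ρ i ⟧ + + 17 * t) (pos-join e s)) , s-good) ,
  ℕ.<-≤-trans (join-< (ρ i) (join-< e s<)) (ℕ.≤-reflexive (sym (ℕ.*-assoc 17 17 (289 ℕ.^ h))))

goods-unique : ∀ h → Unique (goods h)
goods-unique zero    = [] ∷ []
goods-unique (suc h) = cartesianProductWith⁺ (λ i → join (ρ i)) (λ eq → let ρ≡ρ , D≡D = join-injective eq in ρ-injective ρ≡ρ , D≡D) (allFin⁺ 2)
  (cartesianProductWith⁺ join join-injective (allFin⁺ 17) (goods-unique h))

flags : ℕ → List (ℕ × ℕ)
flags h = cartesianProduct (upTo (17 ℕ.^ h)) (goods h)

flags-unique : ∀ h → Unique (flags h)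
flags-unique h = cartesianProduct⁺ (upTo⁺ (17 ℕ.^ h)) (goods-unique h)

length-cartesianProductWith : ∀ {A B C : Set} (f : A → B → C) xs ys →
  length (cartesianProductWith f xs ys) ≡ length xs ℕ.* length ys
length-cartesianProductWith f []       ys = refl
length-cartesianProductWith f (x ∷ xs) ys = trans (length-++ (map (f x) ys))
  (cong₂ ℕ._+_ (length-map (f x) ys) (length-cartesianProductWith f xs ys))

length-goods : ∀ h → length (goods h) ≡ 34 ℕ.^ h
length-goods zero    = refl
length-goods (suc h) = begin
  length (goods (suc h))          ≡⟨ length-cartesianProductWith (λ i → join (ρ i)) (allFin 2) Ds ⟩
  2 ℕ.* length Ds                 ≡⟨ cong (2 ℕ.*_) (length-cartesianProductWith join (allFin 17) (goods h)) ⟩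
  2 ℕ.* (17 ℕ.* length (goods h)) ≡⟨ cong (λ l → 2 ℕ.* (17 ℕ.* l)) (length-goods h) ⟩
  2 ℕ.* (17 ℕ.* 34 ℕ.^ h)         ≡⟨ ℕ.*-assoc 2 17 (34 ℕ.^ h) ⟨
  34 ℕ.^ suc h                    ∎
  where
  open ≡-Reasoning
  Ds : List ℕ
  Ds = cartesianProductWith join (allFin 17) (goods h)

^-distribʳ-* : ∀ h m n → (m ℕ.* n) ℕ.^ h ≡ m ℕ.^ h ℕ.* n ℕ.^ h
^-distribʳ-* zero    m n = refl
^-distribʳ-* (suc h) m n = trans (cong (m ℕ.* n ℕ.*_) (^-distribʳ-* h m n)) (ℕ.[m*n]*[o*p]≡[m*o]*[n*p] m n (m ℕ.^ h) (n ℕ.^ h))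

length-flags : ∀ h → length (flags h) ≡ 578 ℕ.^ h
length-flags h = begin
  length (flags h)                              ≡⟨ length-cartesianProductWith _,_ (upTo (17 ℕ.^ h)) (goods h) ⟩
  length (upTo (17 ℕ.^ h)) ℕ.* length (goods h) ≡⟨ cong₂ ℕ._*_ (length-upTo (17 ℕ.^ h)) (length-goods h) ⟩
  17 ℕ.^ h ℕ.* 34 ℕ.^ h                         ≡⟨ ^-distribʳ-* h 17 34 ⟨
  578 ℕ.^ h                                     ∎
  where open ≡-Reasoning

-- Minimal blocking sets in an incidence structure.

length-injection : ∀ {A B : Set} (p : A → B) xs ys → Unique xs → (∀ {x} → x ∈ xs → p x ∈ ys) →
  (∀ {x y} → x ∈ xs → y ∈ xs → p x ≡ p y → x ≡ y) → length xs ℕ.≤ length ys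
length-injection p []       ys _ _ _ = ℕ.z≤n
length-injection p (x ∷ xs) ys (x∉ ∷ xs!) p∈ p-inj with ∈-∃++ (p∈ (here refl))
... | us , vs , refl = ℕ.≤-trans (ℕ.s≤s (length-injection p xs (us ++ vs) xs! p∈′ (λ y∈ z∈ → p-inj (there y∈) (there z∈))))
  (ℕ.≤-reflexive (begin
    suc (length (us ++ vs))           ≡⟨ cong suc (length-++ us) ⟩
    suc (length us ℕ.+ length vs)     ≡⟨ ℕ.+-suc (length us) (length vs) ⟨
    length us ℕ.+ suc (length vs)     ≡⟨ length-++ us ⟨
    length (us ++ p x ∷ vs)           ∎))
  where
  open ≡-Reasoning
  p∈′ : ∀ {y} → y ∈ xs → p y ∈ us ++ vs
  p∈′ {y} y∈ with ∈-++⁻ us (p∈ (there y∈))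
  ... | inj₁ ∈us          = ∈-++⁺ˡ ∈us
  ... | inj₂ (there ∈vs)  = ∈-++⁺ʳ us ∈vs
  ... | inj₂ (here py≡px) = contradiction (sym (p-inj (there y∈) (here refl) py≡px)) (All.lookup x∉ y∈)

-- `blocks?` yields an unblocked line rather than a mere refutation, since that line serves as a
-- tangent.
module Incidence {P L : Set} (_≟_ : DecidableEquality P) (_∈ℓ_ : P → L → Set)
  (∈ℓ? : ∀ x ℓ → Dec (x ∈ℓ ℓ)) (blocks? : ∀ B → (∀ ℓ → Any (_∈ℓ ℓ) B) ⊎ ∃ λ ℓ → ¬ Any (_∈ℓ ℓ) B) where

  Blocks : List P → Set
  Blocks B = ∀ ℓ → Any (_∈ℓ ℓ) B

  -- Positive evidence that x cannot be removed from a blocking set: without x the line would be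
  -- missed.
  Tangent : P → List P → Set
  Tangent x B = ∃ λ ℓ → ∀ {y} → y ∈ B → y ∈ℓ ℓ → y ≡ x

  infixl 5 _without_
  _without_ : List P → P → List P
  B without x = filter (λ y → ¬? (y ≟ x)) B

  -- If removing x leaves a line unblocked, any other point of B on that line would have survived
  -- the removal; so the line is tangent at x.
  removable : ∀ B xs → (∃ λ x → x ∈ xs × Blocks (B without x)) ⊎ (∀ {x} → x ∈ xs → Tangent x B)
  removable B []       = inj₂ λ ()
  removable B (x ∷ xs) with blocks? (B without x) | removable B xs
  ... | inj₁ blocks | _ = inj₁ (x , here refl , blocks)
  ... | inj₂ _ | inj₁ (y , y∈ , blocks) = inj₁ (y , there y∈ , blocks)
  ... | inj₂ (ℓ , unblocked) | inj₂ tangent = inj₂ λ where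
    (here refl) → ℓ , λ {y} y∈ y∈ℓ → decidable-stable (y ≟ x) λ y≢x →
      unblocked (lose (∈-filter⁺ (λ y → ¬? (y ≟ x)) y∈ y≢x) y∈ℓ)
    (there x∈)  → tangent x∈

  -- Greedy deletion until every remaining point has a tangent. The bound n on the length makes the
  -- recursion structural.
  reduce : ∀ n B → length B ℕ.≤ n → Unique B → Blocks B → ∃ λ R →
    Unique R × (∀ {x} → x ∈ R → x ∈ B) × Blocks R × (∀ {x} → x ∈ R → Tangent x R)
  reduce n B B≤n B! blocks with removable B B
  ... | inj₂ tangent = B , B! , (λ x∈ → x∈) , blocks , tangent
  ... | inj₁ (x , x∈ , blocks′) with n | ℕ.≤-trans (filter-notAll (λ y → ¬? (y ≟ x)) B (lose x∈ λ x≢x → x≢x refl)) B≤n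
  ...   | suc n′ | ℕ.s≤s B′≤n′ =
    let R , R! , R⊆ , rest = reduce n′ (B without x) B′≤n′ (filter⁺ (λ y → ¬? (y ≟ x)) B!) blocks′
    in R , R! , (λ y∈ → proj₁ (∈-filter⁻ (λ y → ¬? (y ≟ x)) {xs = B} (R⊆ y∈))) , rest

  module _ {F : Set} (p : F → P) (m : F → L) (flags : List F) where

    Admissible : P → Set
    Admissible x = ∀ {f} → f ∈ flags → x ∈ℓ m f → x ≡ p f

    admissible? : ∀ x → Dec (All (λ f → x ∈ℓ m f → x ≡ p f) flags)
    admissible? x = All.all? (λ f → ∈ℓ? x (m f) →-dec (x ≟ p f)) flags

    -- The reduction starts from all admissible points, which block by the last hypothesis. The
    -- reduced set still meets each line `m f`, where admissibility allows only `p f`, so it retains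
    -- every flag point.
    minimal-blocking : ∀ universe → (∀ x → x ∈ universe) → Unique flags →
      (∀ {f g} → f ∈ flags → g ∈ flags → p f ∈ℓ m g → f ≡ g) →
      (∀ {f} → f ∈ flags → p f ∈ℓ m f) →
      (∀ ℓ → ∃ λ x → x ∈ℓ ℓ × Admissible x) →
      ∃ λ R → Unique R × Blocks R × (∀ {x} → x ∈ R → Tangent x R) × length flags ℕ.≤ length R
    minimal-blocking universe complete flags! induced incident blocked = R , R! , R-blocks , tangent ,
      -- Flags with a common point are equal: the point of f then lies on the line of g.
      length-injection p flags R flags! p∈R (λ f∈ g∈ pf≡pg → induced f∈ g∈ (subst (_∈ℓ _) (sym pf≡pg) (incident g∈)))
      where
      B : List P
      B = deduplicate _≟_ (filter admissible? universe)
      B-blocks : Blocks B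
      B-blocks ℓ = let x , x∈ℓ , x-adm = blocked ℓ in
        lose (∈-deduplicate⁺ _≟_ (∈-filter⁺ admissible? (complete x) (All.tabulate x-adm))) x∈ℓ
      reduced = reduce (length B) B ℕ.≤-refl (deduplicate-! _≟_ (filter admissible? universe)) B-blocks
      R = proj₁ reduced
      R! = proj₁ (proj₂ reduced)
      R-blocks = proj₁ (proj₂ (proj₂ (proj₂ reduced)))
      tangent : ∀ {x} → x ∈ R → Tangent x R
      tangent = proj₂ (proj₂ (proj₂ (proj₂ reduced)))
      p∈R : ∀ {f} → f ∈ flags → p f ∈ R
      p∈R {f} f∈ with find (R-blocks (m f))
      ... | y , y∈R , y∈ℓ = subst (_∈ R) (All.lookup y-adm f∈ y∈ℓ) y∈R
        where
        y-adm : All (λ f → y ∈ℓ m f → y ≡ p f) flags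
        y-adm = proj₂ (∈-filter⁻ admissible? {xs = universe} (∈-deduplicate⁻ _≟_ _ (proj₁ (proj₂ (proj₂ reduced)) y∈R)))

-- Bounds on flags, and exhaustive search over vectors.

distance² : ℕ → ℕ → ℕ
distance² a b = ∣ + a - + b ∣ ℕ.* ∣ + a - + b ∣

sq-distance : ∀ a b → sq (+ a - + b) ≡ + distance² a b
sq-distance a b = sq-∣∣ (+ a - + b)
  where
  sq-∣∣ : ∀ i → sq i ≡ + (∣ i ∣ ℕ.* ∣ i ∣)
  sq-∣∣ (+ n)    = sym (ℤ.pos-* n n)
  sq-∣∣ -[1+ n ] = refl

distance²<289^h : ∀ h {a b} → a ℕ.< 17 ℕ.^ h → b ℕ.< 17 ℕ.^ h → distance² a b ℕ.< 289 ℕ.^ h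
distance²<289^h h {a} {b} a< b< = subst (distance² a b ℕ.<_) (sym (^-distribʳ-* h 17 17)) (ℕ.*-mono-< ∣a-b∣< ∣a-b∣<)
  where
  ∣a-b∣< : ∣ + a - + b ∣ ℕ.< 17 ℕ.^ h
  ∣a-b∣< = subst (λ i → ∣ i ∣ ℕ.< 17 ℕ.^ h) (sym (ℤ.m-n≡m⊖n a b)) (ℕ.≤-<-trans (ℤ.∣m⊝n∣≤m⊔n a b) (ℕ.⊔-lub a< b<))

flag-bounds : ∀ h {a s} → (a , s) ∈ flags h → a ℕ.< 17 ℕ.^ h × Good h (+ s) × s ℕ.< 289 ℕ.^ h
flag-bounds h as∈ with ∈-cartesianProduct⁻ (upTo (17 ℕ.^ h)) (goods h) as∈
... | a∈ , s∈ = ∈-upTo⁻ a∈ , goods-good h s∈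

search : ∀ {q} n {P : Vec (Fin q) n → Set} → (∀ v → Dec (P v)) → (∀ v → P v) ⊎ ∃ λ v → ¬ P v
search zero P? with P? []
... | yes p = inj₁ λ { [] → p }
... | no ¬p = inj₂ ([] , ¬p)
search {q} (suc n) {P} P? = go (all? tail?)
  where
  tail? : ∀ i → Dec (∀ v → P (i ∷ v))
  tail? i = [ yes , (λ (v , ¬p) → no λ ps → ¬p (ps v)) ]′ (search n (λ v → P? (i ∷ v)))
  go : Dec (∀ i v → P (i ∷ v)) → (∀ v → P v) ⊎ ∃ λ v → ¬ P v
  go (yes ps) = inj₁ λ { (i ∷ v) → ps i v }
  go (no ¬ps) with ¬∀⟶∃¬ q _ tail? ¬ps
  ... | i , ¬pi with search n (λ v → P? (i ∷ v))
  ...   | inj₁ pi       = contradiction pi ¬pi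
  ...   | inj₂ (v , ¬p) = inj₂ (i ∷ v , ¬p)

-- Arithmetic modulo q and normal forms of points.

module Plane (q : ℕ) (q-prime : Prime q) where
  open PG2 q q-prime renaming (_+_ to _+′_; _*_ to _*′_)

  private instance
    q-nonZero : NonZero q
    q-nonZero = prime⇒nonZero q-prime

  1<q : 1 ℕ.< q
  1<q = ℕ.nonTrivial⇒n>1 q {{prime⇒nonTrivial q-prime}}

  infix 4 _≋_
  _≋_ : ℤ → ℤ → Set
  a ≋ b = a ≈ b [mod q ]

  residue : ℤ → 𝔽
  residue z = fromℕ< (ℤ.n%ℕd<d z q)

  residue-≋ : ∀ z → ⟦ residue z ⟧ ≋ z
  residue-≋ z = congruent (divides (- (z ℤ./ℕ q)) (begin
    ⟦ residue z ⟧ - z                                        ≡⟨ cong (λ n → + n - z) (toℕ-fromℕ< (ℤ.n%ℕd<d z q)) ⟩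
    + (z ℤ.%ℕ q) - z                                         ≡⟨ cong (λ t → + (z ℤ.%ℕ q) - t) (ℤ.a≡a%ℕn+[a/ℕn]*n z q) ⟩
    + (z ℤ.%ℕ q) - (+ (z ℤ.%ℕ q) + (z ℤ./ℕ q) * + q)         ≡⟨ lem (+ (z ℤ.%ℕ q)) (z ℤ./ℕ q) (+ q) ⟩
    - (z ℤ./ℕ q) * + q                                       ∎))
    where
    open ≡-Reasoning
    lem : ∀ r d n → r - (r + d * n) ≡ - d * n
    lem = solve-∀

  mod-≋ : ∀ n → ⟦ n mod q ⟧ ≋ + n
  mod-≋ n = subst (λ i → ⟦ i ⟧ ≋ + n) (toℕ-injective (trans (toℕ-fromℕ< (ℤ.n%ℕd<d (+ n) q)) (sym (toℕ-fromℕ< (m%n<n n q))))) (residue-≋ (+ n))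

  q∣-resp : ∀ {a b} → b ≡ a → + q ∣ a → + q ∣ b
  q∣-resp b≡a = subst (+ q ∣_) (sym b≡a)

  ≋-trans : ∀ {a b c} → a ≋ b → b ≋ c → a ≋ c
  ≋-trans {a} {b} {c} p r = congruent (q∣-resp (lem a b c) (∣m∣n⇒∣m+n (difference p) (difference r)))
    where
    lem : ∀ a b c → a - c ≡ (a - b) + (b - c)
    lem = solve-∀

  ≋-sym : ∀ {a b} → a ≋ b → b ≋ a
  ≋-sym {a} {b} p = congruent (q∣-resp (lem a b) (∣m⇒∣-m (difference p)))
    where
    lem : ∀ a b → b - a ≡ - (a - b)
    lem = solve-∀

  ≋-refl : ∀ {a} → a ≋ a
  ≋-refl {a} = congruent (divides (+ 0) (ℤ.i≡j⇒i-j≡0 {a} refl))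

  +-≋ : ∀ {a b c d} → a ≋ b → c ≋ d → a + c ≋ b + d
  +-≋ {a} {b} {c} {d} p r = congruent (q∣-resp (lem a b c d) (∣m∣n⇒∣m+n (difference p) (difference r)))
    where
    lem : ∀ a b c d → a + c - (b + d) ≡ (a - b) + (c - d)
    lem = solve-∀

  *-≋ : ∀ {a b c d} → a ≋ b → c ≋ d → a * c ≋ b * d
  *-≋ {a} {b} {c} {d} p r = congruent (q∣-resp (lem a b c d) (∣m∣n⇒∣m+n (∣m⇒∣m*n c (difference p)) (∣n⇒∣m*n b (difference r))))
    where
    lem : ∀ a b c d → a * c - b * d ≡ (a - b) * c + b * (c - d)
    lem = solve-∀

  +′-≋ : ∀ x y → ⟦ x +′ y ⟧ ≋ ⟦ x ⟧ + ⟦ y ⟧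
  +′-≋ x y = mod-≋ (toℕ x ℕ.+ toℕ y)

  *′-≋ : ∀ x y → ⟦ x *′ y ⟧ ≋ ⟦ x ⟧ * ⟦ y ⟧
  *′-≋ x y = subst (⟦ x *′ y ⟧ ≋_) (ℤ.pos-* (toℕ x) (toℕ y)) (mod-≋ (toℕ x ℕ.* toℕ y))

  ⟦0#⟧ : ⟦ 0# ⟧ ≡ + 0
  ⟦0#⟧ = cong +_ (trans (toℕ-fromℕ< (m%n<n 0 q)) (m<n⇒m%n≡m (ℕ.<-trans (ℕ.s≤s ℕ.z≤n) 1<q)))

  1# : 𝔽
  1# = fromℕ< 1<q

  ⟦1#⟧ : ⟦ 1# ⟧ ≡ + 1
  ⟦1#⟧ = cong +_ (toℕ-fromℕ< 1<q)

  q∤1 : ¬ + q ∣ + 1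
  q∤1 q∣1 with ≈⇒≡ {1} {0} 1<q (ℕ.<-trans (ℕ.s≤s ℕ.z≤n) 1<q) (congruent q∣1)
  ... | ()

  1≢0 : 1# ≢ 0#
  1≢0 eq with trans (sym ⟦1#⟧) (trans (cong ⟦_⟧ eq) ⟦0#⟧)
  ... | ()

  dotℤ : Vec 𝔽 3 → Vec 𝔽 3 → ℤ
  dotℤ (x₀ ∷ x₁ ∷ x₂ ∷ []) (a₀ ∷ a₁ ∷ a₂ ∷ []) = ⟦ x₀ ⟧ * ⟦ a₀ ⟧ + ⟦ x₁ ⟧ * ⟦ a₁ ⟧ + ⟦ x₂ ⟧ * ⟦ a₂ ⟧

  dot-≋ : ∀ x a → ⟦ dot x a ⟧ ≋ dotℤ x a
  dot-≋ (x₀ ∷ x₁ ∷ x₂ ∷ []) (a₀ ∷ a₁ ∷ a₂ ∷ []) =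
    ≋-trans (+′-≋ (x₀ *′ a₀ +′ x₁ *′ a₁) (x₂ *′ a₂))
      (+-≋ (≋-trans (+′-≋ (x₀ *′ a₀) (x₁ *′ a₁)) (+-≋ (*′-≋ x₀ a₀) (*′-≋ x₁ a₁))) (*′-≋ x₂ a₂))

  ≋0⇒on : ∀ x a → dotℤ x a ≋ + 0 → dot x a ≡ 0#
  ≋0⇒on x a x·a≋0 = ⟦⟧-injective (subst (⟦ dot x a ⟧ ≋_) (sym ⟦0#⟧) (≋-trans (dot-≋ x a) x·a≋0))

  on⇒≋0 : ∀ x a → dot x a ≡ 0# → dotℤ x a ≋ + 0
  on⇒≋0 x a x·a≡0 = subst (dotℤ x a ≋_) (trans (cong ⟦_⟧ x·a≡0) ⟦0#⟧) (≋-sym (dot-≋ x a))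

  -- One representative of every point: (1 : x : y), (0 : 1 : m) and (0 : 0 : 1).
  data Normal : Set where
    affine    : (x y : 𝔽) → Normal
    direction : (m : 𝔽) → Normal
    vertical  : Normal

  vector : Normal → Vec 𝔽 3
  vector (affine x y)  = 1# ∷ x ∷ y ∷ []
  vector (direction m) = 0# ∷ 1# ∷ m ∷ []
  vector vertical      = 0# ∷ 0# ∷ 1# ∷ []

  vector≢0 : ∀ x → vector x ≢ replicate 3 0#
  vector≢0 (affine x y)  eq = 1≢0 (cong Vec.head eq)
  vector≢0 (direction m) eq = 1≢0 (cong (λ v → Vec.head (Vec.tail v)) eq)
  vector≢0 vertical      eq = 1≢0 (cong (λ v → Vec.head (Vec.tail (Vec.tail v))) eq)

  point : Normal → Point
  point x = vector x , vector≢0 x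

  infix 4 _≟ₙ_
  _≟ₙ_ : DecidableEquality Normal
  affine x y  ≟ₙ affine x′ y′  = map′ (λ { (refl , refl) → refl }) (λ { refl → refl , refl }) (x ≟ x′ ×-dec y ≟ y′)
  affine _ _  ≟ₙ direction _   = no λ ()
  affine _ _  ≟ₙ vertical      = no λ ()
  direction _ ≟ₙ affine _ _    = no λ ()
  direction m ≟ₙ direction m′  = map′ (cong direction) (λ { refl → refl }) (m ≟ m′)
  direction _ ≟ₙ vertical      = no λ ()
  vertical    ≟ₙ affine _ _    = no λ ()
  vertical    ≟ₙ direction _   = no λ ()
  vertical    ≟ₙ vertical      = yes refl

  normals : List Normal
  normals = vertical ∷ map direction (allFin q) ++ cartesianProductWith affine (allFin q) (allFin q)

  ∈-normals : ∀ x → x ∈ normals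
  ∈-normals (affine x y)  = there (∈-++⁺ʳ (map direction (allFin q)) (∈-cartesianProductWith⁺ affine (∈-allFin x) (∈-allFin y)))
  ∈-normals (direction m) = there (∈-++⁺ˡ (∈-map⁺ direction (∈-allFin m)))
  ∈-normals vertical      = here refl

  open Setoid points using () renaming (_≈_ to _≈ₚ_)

  ∈-span : ∀ v → span v (proj₁ v)
  ∈-span (v , _) = 1# , sym (identity v)
    where
    1*x≡x : ∀ x → 1# *′ x ≡ x
    1*x≡x x = ⟦⟧-injective (≋-trans (*′-≋ 1# x) (subst (_≋ ⟦ x ⟧) (sym (trans (cong (_* ⟦ x ⟧) ⟦1#⟧) (ℤ.*-identityˡ ⟦ x ⟧))) ≋-refl))
    identity : ∀ {n} (v : Vec 𝔽 n) → Vec.map (1# *′_) v ≡ v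
    identity []      = refl
    identity (x ∷ v) = cong₂ _∷_ (1*x≡x x) (identity v)

  -- A vector spanning y is a multiple of the one spanning x, and the dot product is linear.
  on-resp-≈ : ∀ {x y} ℓ → x ≈ₚ y → x on ℓ → y on ℓ
  on-resp-≈ {x} {y} ℓ (_ , span-y⊆span-x) x∈ℓ with span-y⊆span-x (∈-span y)
  ... | k , y≡kx = subst (λ v → dot v (proj₁ ℓ) ≡ 0#) (sym y≡kx) (scaled (proj₁ x) (proj₁ ℓ) x∈ℓ)
    where
    scaled : ∀ x a → dot x a ≡ 0# → dot (Vec.map (k *′_) x) a ≡ 0#
    scaled x@(x₀ ∷ x₁ ∷ x₂ ∷ []) a@(a₀ ∷ a₁ ∷ a₂ ∷ []) x∈a = ≋0⇒on (Vec.map (k *′_) x) a (≋-trans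
      (+-≋ (+-≋ (*-≋ (*′-≋ k x₀) ≋-refl) (*-≋ (*′-≋ k x₁) ≋-refl)) (*-≋ (*′-≋ k x₂) ≋-refl))
      (subst₂ _≋_ (lem ⟦ k ⟧ ⟦ x₀ ⟧ ⟦ x₁ ⟧ ⟦ x₂ ⟧ ⟦ a₀ ⟧ ⟦ a₁ ⟧ ⟦ a₂ ⟧) (ℤ.*-zeroʳ ⟦ k ⟧)
        (*-≋ (≋-refl {⟦ k ⟧}) (on⇒≋0 x a x∈a))))
      where
      lem : ∀ k x₀ x₁ x₂ a₀ a₁ a₂ → k * (x₀ * a₀ + x₁ * a₁ + x₂ * a₂) ≡ (k * x₀) * a₀ + (k * x₁) * a₁ + (k * x₂) * a₂
      lem = solve-∀

  scalar-≋ : ∀ {k} {y x : 𝔽} → y ≡ k *′ x → ⟦ y ⟧ ≋ ⟦ k ⟧ * ⟦ x ⟧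
  scalar-≋ {k} {y} {x} eq = subst (λ z → ⟦ z ⟧ ≋ ⟦ k ⟧ * ⟦ x ⟧) (sym eq) (*′-≋ k x)

  1≢k*0 : ∀ {k} → 1# ≢ k *′ 0#
  1≢k*0 {k} eq = q∤1 (difference (subst₂ _≋_ ⟦1#⟧ (trans (cong (⟦ k ⟧ *_) ⟦0#⟧) (ℤ.*-zeroʳ ⟦ k ⟧)) (scalar-≋ {k} {1#} {0#} eq)))

  scale-by-one : ∀ {k} {x y : 𝔽} → 1# ≡ k *′ 1# → y ≡ k *′ x → x ≡ y
  scale-by-one {k} {x} {y} 1≡k y≡kx = ⟦⟧-injective (≋-sym (≋-trans (scalar-≋ {k} y≡kx)
    (subst (⟦ k ⟧ * ⟦ x ⟧ ≋_) (ℤ.*-identityˡ ⟦ x ⟧) (*-≋ (≋-sym 1≋k) ≋-refl))))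
    where
    1≋k : + 1 ≋ ⟦ k ⟧
    1≋k = subst₂ _≋_ ⟦1#⟧ (trans (cong (⟦ k ⟧ *_) ⟦1#⟧) (ℤ.*-identityʳ ⟦ k ⟧)) (scalar-≋ {k} {1#} {1#} 1≡k)

  -- The first nonzero coordinate is always 1. If the leading positions agree, the scalar is 1; if
  -- not, one of the two proportionalities reads 1 = k · 0.
  point-injective : ∀ {x y} → point x ≈ₚ point y → x ≡ y
  point-injective {x} {y} (x⊆y , y⊆x) = injective x y (x⊆y (∈-span (point x))) (y⊆x (∈-span (point y)))
    where
    injective : ∀ x y → span (point y) (vector x) → span (point x) (vector y) → x ≡ y
    injective (affine x y) (affine x′ y′) _ (k , eq) =
      let e₀ , eq₁ = ∷-injective eq ; e₁ , eq₂ = ∷-injective eq₁ ; e₂ , _ = ∷-injective eq₂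
      in cong₂ affine (scale-by-one {k} e₀ e₁) (scale-by-one {k} e₀ e₂)
    injective (affine _ _)  (direction _) (k , eq) _ = contradiction (proj₁ (∷-injective eq)) (1≢k*0 {k})
    injective (affine _ _)  vertical      (k , eq) _ = contradiction (proj₁ (∷-injective eq)) (1≢k*0 {k})
    injective (direction _) (affine _ _)  _ (k , eq) = contradiction (proj₁ (∷-injective eq)) (1≢k*0 {k})
    injective (direction m) (direction m′) _ (k , eq) =
      let _ , eq₁ = ∷-injective eq ; e₁ , eq₂ = ∷-injective eq₁ ; e₂ , _ = ∷-injective eq₂
      in cong direction (scale-by-one {k} e₁ e₂)
    injective (direction _) vertical (k , eq) _ = contradiction (proj₁ (∷-injective (proj₂ (∷-injective eq)))) (1≢k*0 {k})
    injective vertical (affine _ _)  _ (k , eq) = contradiction (proj₁ (∷-injective eq)) (1≢k*0 {k})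
    injective vertical (direction _) _ (k , eq) = contradiction (proj₁ (∷-injective (proj₂ (∷-injective eq)))) (1≢k*0 {k})
    injective vertical vertical      _ _ = refl

  -- Blocking and minimality in the plane.

  infix 4 _∈ℓ_
  _∈ℓ_ : Normal → Line → Set
  x ∈ℓ ℓ = point x on ℓ

  blocks? : ∀ B → (∀ ℓ → Any (_∈ℓ ℓ) B) ⊎ ∃ λ ℓ → ¬ Any (_∈ℓ ℓ) B
  -- The zero vector is not a line, so it is counted as blocked and the search can run over all
  -- vectors.
  blocks? B with search 3 {λ v → v ≡ replicate 3 0# ⊎ Any (λ x → dot (vector x) v ≡ 0#) B}
    (λ v → ≡-dec _≟_ v (replicate 3 0#) ⊎-dec Any.any? (λ x → dot (vector x) v ≟ 0#) B)
  ... | inj₁ blocked        = inj₁ λ { (v , v≢0) → [ (λ v≡0 → contradiction v≡0 v≢0) , id ]′ (blocked v) }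
  ... | inj₂ (v , ¬blocked) = inj₂ ((v , ¬blocked ∘ inj₁) , ¬blocked ∘ inj₂)

  open Incidence _≟ₙ_ _∈ℓ_ (λ x ℓ → dot (vector x) (proj₁ ℓ) ≟ 0#) blocks?

  points-unique : ∀ {R} → Unique R → UniqueSetoid.Unique points (map point R)
  points-unique = UniquePropertiesSetoid.map⁺ (setoid Normal) points point-injective

  -- A blocking subset A must meet the tangent at each r in R. It does so in a point of R, which can
  -- only be r, so A contains all of R.
  tangent⇒minimal : ∀ {R} (R! : Unique R) → Blocks R → (∀ {x} → x ∈ R → Tangent x R) →
    MinimalBlocking (pointSet (map point R) (points-unique R!))
  tangent⇒minimal {R} R! blocks tangent = (λ ℓ → Any.map⁺ (blocks ℓ)) ,
    λ A (A⊆R , R⊈A) A-blocks → R⊈A λ {z} z∈R →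
      let r , r∈R , z≈r = find (Any.map⁻ z∈R)
          ℓ , only-r    = tangent r∈R
          a , a∈A , a∈ℓ = SetoidMembership.find points (A-blocks ℓ)
          r′ , r′∈R , a≈r′ = find (Any.map⁻ (A⊆R {a} a∈A))
          r′≡r = only-r r′∈R (on-resp-≈ {a} {point r′} ℓ a≈r′ a∈ℓ)
      in SetoidMembership.∈-resp-≈ points {elements A} {a} {z}
           (Setoid.trans points {a} {point r} {z} (subst (λ t → a ≈ₚ point t) r′≡r a≈r′) (Setoid.sym points {z} {point r} z≈r)) a∈A

  -- Inverses and the point at infinity of a line.

  inverse : ∀ {c} → c ≢ 0# → ∃ λ u → u * ⟦ c ⟧ ≋ + 1
  inverse {c} c≢0 with coprime-Bézout (prime⇒coprime q-prime {{ℕ.≢-nonZero c≢0′}} (toℕ<n c))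
    where
    c≢0′ : toℕ c ≢ 0
    c≢0′ eq = c≢0 (toℕ-injective (trans eq (sym (ℤ.+-injective ⟦0#⟧))))
  ... | Bézout.+- x y eq = - + y , congruent (divides (- + x) (begin
      - + y * ⟦ c ⟧ - + 1        ≡⟨ lem (+ y) ⟦ c ⟧ ⟩
      - (+ 1 + + y * ⟦ c ⟧)      ≡⟨ cong (λ t → - (+ 1 + t)) (ℤ.pos-* y (toℕ c)) ⟨
      - + (1 ℕ.+ y ℕ.* toℕ c)    ≡⟨ cong (λ t → - + t) eq ⟩
      - + (x ℕ.* q)              ≡⟨ cong -_ (ℤ.pos-* x q) ⟩
      - (+ x * + q)              ≡⟨ ℤ.neg-distribˡ-* (+ x) (+ q) ⟩
      - + x * + q                ∎))
    where
    open ≡-Reasoning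
    lem : ∀ y c → - y * c - + 1 ≡ - (+ 1 + y * c)
    lem = solve-∀
  ... | Bézout.-+ x y eq = + y , congruent (divides (+ x) (begin
      + y * ⟦ c ⟧ - + 1          ≡⟨ cong (_- + 1) (ℤ.pos-* y (toℕ c)) ⟨
      + (y ℕ.* toℕ c) - + 1      ≡⟨ cong (λ t → + t - + 1) eq ⟨
      + 1 + + (x ℕ.* q) - + 1    ≡⟨ lem (+ (x ℕ.* q)) ⟩
      + (x ℕ.* q)                ≡⟨ ℤ.pos-* x q ⟩
      + x * + q                  ∎))
    where
    open ≡-Reasoning
    lem : ∀ t → + 1 + t - + 1 ≡ t
    lem = solve-∀

  -- Carries a congruence across a ring identity between the two differences.
  ≋-shift : ∀ {a b c d} → c - d ≡ a - b → a ≋ b → c ≋ d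
  ≋-shift eq (congruent q∣) = congruent (q∣-resp eq q∣)

  ≡⇒≋ : ∀ {a b} → a ≡ b → a ≋ b
  ≡⇒≋ refl = ≋-refl

  -- The line is c₀ + c₁x + c₂y = 0: vertical (or at infinity) if c₂ = 0, and of slope -c₁/c₂
  -- otherwise. The inverse u of c₂ is returned for use in the affine equation.
  at-infinity : ∀ c₀ c₁ c₂ c≢0 → let ℓ = (c₀ ∷ c₁ ∷ c₂ ∷ []) , c≢0 in
    vertical ∈ℓ ℓ ⊎ ∃ λ u → u * ⟦ c₂ ⟧ ≋ + 1 × direction (residue (- (u * ⟦ c₁ ⟧))) ∈ℓ ℓ
  at-infinity c₀ c₁ c₂ c≢0 with c₂ ≟ 0#
  ... | yes refl = inj₁ (≋0⇒on (vector vertical) (c₀ ∷ c₁ ∷ c₂ ∷ []) (≡⇒≋ (begin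
      ⟦ 0# ⟧ * ⟦ c₀ ⟧ + ⟦ 0# ⟧ * ⟦ c₁ ⟧ + ⟦ 1# ⟧ * ⟦ 0# ⟧
        ≡⟨ cong (λ z → z * ⟦ c₀ ⟧ + z * ⟦ c₁ ⟧ + ⟦ 1# ⟧ * z) ⟦0#⟧ ⟩
      + 0 * ⟦ c₀ ⟧ + + 0 * ⟦ c₁ ⟧ + ⟦ 1# ⟧ * + 0
        ≡⟨ lem ⟦ c₀ ⟧ ⟦ c₁ ⟧ ⟦ 1# ⟧ ⟩
      + 0 ∎)))
    where
    open ≡-Reasoning
    lem : ∀ x y z → + 0 * x + + 0 * y + z * + 0 ≡ + 0
    lem = solve-∀
  ... | no c₂≢0 with inverse c₂≢0
  ... | u , uc₂≋1 = inj₂ (u , uc₂≋1 , ≋0⇒on (vector (direction m)) (c₀ ∷ c₁ ∷ c₂ ∷ []) (≋-trans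
      (+-≋ (≡⇒≋ (cong₂ (λ z o → z * ⟦ c₀ ⟧ + o * ⟦ c₁ ⟧) ⟦0#⟧ ⟦1#⟧)) (*-≋ (residue-≋ (- (u * ⟦ c₁ ⟧))) (≋-refl {⟦ c₂ ⟧})))
      (≋-shift (lem u ⟦ c₀ ⟧ ⟦ c₁ ⟧ ⟦ c₂ ⟧) (*-≋ (≋-refl { - ⟦ c₁ ⟧}) uc₂≋1))))
    where
    m = residue (- (u * ⟦ c₁ ⟧))
    lem : ∀ u c₀ c₁ c₂ → + 0 * c₀ + + 1 * c₁ + - (u * c₁) * c₂ - + 0 ≡ - c₁ * (u * c₂) - - c₁ * + 1
    lem = solve-∀

  -- Flag points and flag lines.

  flag-point : ℕ × ℕ → Normal
  flag-point (a , s) = affine (residue (+ a)) (residue (+ a * + a + + s))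

  -- The equation (a² - s) - 2ax + y = 0, which is y = 2ax - a² + s.
  flag-line : ℕ × ℕ → Line
  flag-line (a , s) = residue (+ a * + a - + s) ∷ residue (- (+ 2 * + a)) ∷ 1# ∷ [] ,
    λ eq → 1≢0 (cong (λ v → Vec.head (Vec.tail (Vec.tail v))) eq)

  flag-dot : ∀ x₀ x₁ x₂ a s → dotℤ (x₀ ∷ x₁ ∷ x₂ ∷ []) (proj₁ (flag-line (a , s))) ≋
    ⟦ x₀ ⟧ * (+ a * + a - + s) + ⟦ x₁ ⟧ * - (+ 2 * + a) + ⟦ x₂ ⟧
  flag-dot x₀ x₁ x₂ a s = +-≋
    (+-≋ (*-≋ (≋-refl {⟦ x₀ ⟧}) (residue-≋ (+ a * + a - + s))) (*-≋ (≋-refl {⟦ x₁ ⟧}) (residue-≋ (- (+ 2 * + a)))))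
    (≡⇒≋ (trans (cong (⟦ x₂ ⟧ *_) ⟦1#⟧) (ℤ.*-identityʳ ⟦ x₂ ⟧)))

  affine∈flag-line⇒ : ∀ {x y a s} → affine x y ∈ℓ flag-line (a , s) →
    ⟦ y ⟧ ≋ + 2 * + a * ⟦ x ⟧ - + a * + a + + s
  affine∈flag-line⇒ {x} {y} {a} {s} x∈ℓ = ≋-shift (begin
      ⟦ y ⟧ - (+ 2 * + a * ⟦ x ⟧ - + a * + a + + s)
        ≡⟨ lem ⟦ x ⟧ ⟦ y ⟧ (+ a) (+ s) ⟩
      + 1 * (+ a * + a - + s) + ⟦ x ⟧ * - (+ 2 * + a) + ⟦ y ⟧ - + 0
        ≡⟨ cong (λ o → o * (+ a * + a - + s) + ⟦ x ⟧ * - (+ 2 * + a) + ⟦ y ⟧ - + 0) ⟦1#⟧ ⟨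
      ⟦ 1# ⟧ * (+ a * + a - + s) + ⟦ x ⟧ * - (+ 2 * + a) + ⟦ y ⟧ - + 0 ∎)
    (≋-trans (≋-sym (flag-dot 1# x y a s)) (on⇒≋0 (vector (affine x y)) (proj₁ (flag-line (a , s))) x∈ℓ))
    where
    open ≡-Reasoning
    lem : ∀ x y a s → y - (+ 2 * a * x - a * a + s) ≡ + 1 * (a * a - s) + x * - (+ 2 * a) + y - + 0
    lem = solve-∀

  flag-incident : ∀ f → flag-point f ∈ℓ flag-line f
  flag-incident f@(a , s) = ≋0⇒on (vector (flag-point f)) (proj₁ (flag-line f)) (≋-trans (flag-dot 1# x y a s)
    (≋-trans (+-≋ (+-≋ (≡⇒≋ (cong (_* (+ a * + a - + s)) ⟦1#⟧)) (*-≋ (residue-≋ (+ a)) (≋-refl { - (+ 2 * + a)}))) (residue-≋ (+ a * + a + + s)))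
      (≡⇒≋ (lem (+ a) (+ s)))))
    where
    x = residue (+ a)
    y = residue (+ a * + a + + s)
    lem : ∀ a s → + 1 * (a * a - s) + a * - (+ 2 * a) + (a * a + s) ≡ + 0
    lem = solve-∀

  -- At abscissa a the flag line has the single ordinate a² + s, so admissibility only needs the
  -- abscissas to agree.
  meets-flag-point : ∀ {x y f} → x ≡ proj₁ f → affine (residue (+ x)) y ∈ℓ flag-line f →
    affine (residue (+ x)) y ≡ flag-point f
  meets-flag-point {f = a , s} refl x∈ℓ = cong (affine (residue (+ a))) (⟦⟧-injective (≋-trans (affine∈flag-line⇒ {a = a} {s} x∈ℓ)
    (≋-trans (+-≋ (+-≋ (*-≋ (≋-refl {+ 2 * + a}) (residue-≋ (+ a))) (≋-refl { - (+ a * + a)})) (≋-refl {+ s}))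
      (≋-trans (≡⇒≋ (lem (+ a) (+ s))) (≋-sym (residue-≋ (+ a * + a + + s)))))))
    where
    lem : ∀ a s → + 2 * a * a - a * a + s ≡ a * a + s
    lem = solve-∀

  vertical∉flag-line : ∀ f → ¬ vertical ∈ℓ flag-line f
  vertical∉flag-line f@(a , s) x∈ℓ = q∤1 (difference (≋-trans (≡⇒≋ (begin
      + 1
        ≡⟨ lem (+ a * + a - + s) (- (+ 2 * + a)) ⟩
      + 0 * (+ a * + a - + s) + + 0 * - (+ 2 * + a) + + 1
        ≡⟨ cong₂ (λ z o → z * (+ a * + a - + s) + z * - (+ 2 * + a) + o) ⟦0#⟧ ⟦1#⟧ ⟨
      ⟦ 0# ⟧ * (+ a * + a - + s) + ⟦ 0# ⟧ * - (+ 2 * + a) + ⟦ 1# ⟧ ∎))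
    (≋-trans (≋-sym (flag-dot 0# 0# 1# a s)) (on⇒≋0 (vector vertical) (proj₁ (flag-line f)) x∈ℓ))))
    where
    open ≡-Reasoning
    lem : ∀ x y → + 1 ≡ + 0 * x + + 0 * y + + 1
    lem = solve-∀

  direction∈flag-line⇒ : ∀ {m a s} → direction m ∈ℓ flag-line (a , s) → ⟦ m ⟧ ≋ + 2 * + a
  direction∈flag-line⇒ {m} {a} {s} x∈ℓ = ≋-shift (begin
      ⟦ m ⟧ - + 2 * + a
        ≡⟨ lem ⟦ m ⟧ (+ a) (+ a * + a - + s) ⟩
      + 0 * (+ a * + a - + s) + + 1 * - (+ 2 * + a) + ⟦ m ⟧ - + 0
        ≡⟨ cong₂ (λ z o → z * (+ a * + a - + s) + o * - (+ 2 * + a) + ⟦ m ⟧ - + 0) ⟦0#⟧ ⟦1#⟧ ⟨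
      ⟦ 0# ⟧ * (+ a * + a - + s) + ⟦ 1# ⟧ * - (+ 2 * + a) + ⟦ m ⟧ - + 0 ∎)
    (≋-trans (≋-sym (flag-dot 0# 1# m a s)) (on⇒≋0 (vector (direction m)) (proj₁ (flag-line (a , s))) x∈ℓ))
    where
    open ≡-Reasoning
    lem : ∀ m a x → m - + 2 * a ≡ + 0 * x + + 1 * - (+ 2 * a) + m - + 0
    lem = solve-∀

  -- The construction at scale h: induced flags and blocking by admissible points.

  module _ (h : ℕ) (3N≤q : 3 ℕ.* 289 ℕ.^ h ℕ.≤ q) where
    private
      X N : ℕ
      X = 17 ℕ.^ h
      N = 289 ℕ.^ h

    N+N+N≤q : N ℕ.+ N ℕ.+ N ℕ.≤ q
    N+N+N≤q = subst (ℕ._≤ q) (trans (cong (λ n → N ℕ.+ (N ℕ.+ n)) (ℕ.+-identityʳ N)) (sym (ℕ.+-assoc N N N))) 3N≤q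

    N+N≤q : N ℕ.+ N ℕ.≤ q
    N+N≤q = ℕ.≤-trans (ℕ.m≤m+n (N ℕ.+ N) N) N+N+N≤q

    N≤q : N ℕ.≤ q
    N≤q = ℕ.≤-trans (ℕ.m≤m+n N N) N+N≤q

    -- Here D − N represents a residue mod q in the range from −N to q − N − 1; integers outside
    -- [−N, N) are so far from S that x = a works.
    separation-residue : ∀ {D a} → D ℕ.< q → a ℕ.< X → ∃ λ x → (∀ {b s} → (b , s) ∈ flags h →
      + D - + N + sq (+ x - + b) ≋ + s + sq (+ x - + a) → x ≡ b)
    separation-residue {D} {a} D<q a<X with N ℕ.+ N ℕ.≤? D
    ... | yes 2N≤D = a , λ {b} {s} bs∈ a-meets →
      let b<X , _ , s<N = flag-bounds h bs∈
          D′ = D ℕ.∸ N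
          D≡ : N ℕ.+ D′ ≡ D
          D≡ = ℕ.m+[n∸m]≡n (ℕ.≤-trans (ℕ.m≤m+n N N) 2N≤D)
          -- No wraparound occurs, as D′ + (a - b)² < D′ + N = D < q. The equation contradicts s < N
          -- ≤ D′.
          D′+δ≡s : D′ ℕ.+ distance² a b ≡ s
          D′+δ≡s = ≈⇒≡
            (ℕ.<-≤-trans (ℕ.+-monoʳ-< D′ (distance²<289^h h a<X b<X)) (ℕ.≤-trans (ℕ.≤-reflexive (trans (ℕ.+-comm D′ N) D≡)) (ℕ.<⇒≤ D<q)))
            (ℕ.<-≤-trans s<N N≤q)
            (≋-shift (begin
              + D′ + + distance² a b - + s
                ≡⟨ cong (λ t → + D′ + t - + s) (sq-distance a b) ⟨
              + D′ + sq (+ a - + b) - + s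
                ≡⟨ lem (+ N) (+ D′) (sq (+ a - + b)) (+ s) (+ a) ⟩
              + N + + D′ - + N + sq (+ a - + b) - (+ s + sq (+ a - + a))
                ≡⟨ cong (λ n → + n - + N + sq (+ a - + b) - (+ s + sq (+ a - + a))) D≡ ⟩
              + D - + N + sq (+ a - + b) - (+ s + sq (+ a - + a)) ∎) a-meets)
          N≤D′ : N ℕ.≤ D′
          N≤D′ = ℕ.+-cancelˡ-≤ N N D′ (subst (N ℕ.+ N ℕ.≤_) (sym D≡) 2N≤D)
      in contradiction (ℕ.≤-<-trans (ℕ.≤-trans N≤D′ (ℕ.m≤m+n D′ _)) (subst (ℕ._< N) (sym D′+δ≡s) s<N)) (ℕ.n≮n N)
      where
      open ≡-Reasoning
      lem : ∀ n d t s a → d + t - s ≡ n + d - n + t - (s + (a - a) * (a - a))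
      lem = solve-∀
    ... | no  2N≰D with avoiding-abscissa h (+ D - + N) a<X
    ...   | x , x<X , unique = x , λ {b} {s} bs∈ x-meets →
      let b<X , s-good , s<N = flag-bounds h bs∈
          -- With N moved to the right both sides are naturals below 3N ≤ q, so the congruence is an
          -- equation.
          D+δ≡ : D ℕ.+ distance² x b ≡ s ℕ.+ N ℕ.+ distance² x a
          D+δ≡ = ≈⇒≡
            (ℕ.<-≤-trans (ℕ.+-mono-< (ℕ.≰⇒> 2N≰D) (distance²<289^h h x<X b<X)) N+N+N≤q)
            (ℕ.<-≤-trans (ℕ.+-mono-< (ℕ.+-monoˡ-< N s<N) (distance²<289^h h x<X a<X)) N+N+N≤q)
            (≋-shift (begin
              + D + + distance² x b - (+ s + + N + + distance² x a)
                ≡⟨ lem (+ D) (+ distance² x b) (+ s) (+ N) (+ distance² x a) ⟩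
              + D - + N + + distance² x b - (+ s + + distance² x a)
                ≡⟨ cong₂ (λ t t′ → + D - + N + t - (+ s + t′)) (sq-distance x b) (sq-distance x a) ⟨
              + D - + N + sq (+ x - + b) - (+ s + sq (+ x - + a)) ∎) x-meets)
      in unique b (+ s) b<X s-good (begin
              + D - + N + sq (+ x - + b)          ≡⟨ cong (λ t → + D - + N + t) (sq-distance x b) ⟩
              + D - + N + + distance² x b         ≡⟨ lem₁ (+ D) (+ N) (+ distance² x b) ⟩
              + (D ℕ.+ distance² x b) - + N       ≡⟨ cong (λ n → + n - + N) D+δ≡ ⟩
              + s + + N + + distance² x a - + N   ≡⟨ lem₂ (+ s) (+ N) (+ distance² x a) ⟩
              + s + + distance² x a               ≡⟨ cong (λ t → + s + t) (sq-distance x a) ⟨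
              + s + sq (+ x - + a)                ∎)
      where
      open ≡-Reasoning
      lem : ∀ d e s n f → d + e - (s + n + f) ≡ d - n + e - (s + f)
      lem = solve-∀
      lem₁ : ∀ d n e → d - n + e ≡ d + e - n
      lem₁ = solve-∀
      lem₂ : ∀ s n f → s + n + f - n ≡ s + f
      lem₂ = solve-∀

    -- Any d is congruent to D - N, where D is the residue of d + N.
    separation : ∀ d {a} → a ℕ.< X → ∃ λ x → (∀ {b s} → (b , s) ∈ flags h →
      d + sq (+ x - + b) ≋ + s + sq (+ x - + a) → x ≡ b)
    separation d {a} a<X with separation-residue (toℕ<n (residue (d + + N))) a<X
    ... | x , separated = x , λ {b} {s} f∈ x-meets → separated f∈
      (≋-trans (+-≋ (≋-shift {c = ⟦ residue (d + + N) ⟧ - + N} {d} (lem ⟦ residue (d + + N) ⟧ d (+ N)) (residue-≋ (d + + N))) (≋-refl {sq (+ x - + b)})) x-meets)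
      where
      lem : ∀ r d n → r - n - d ≡ r - (d + n)
      lem = solve-∀

    -- Incidence says s + (a - b)² ≡ t modulo q. Both sides are below 2N ≤ q, so this is an equation
    -- and `good-rigid` gives a = b, whence s = t.
    flags-induced : ∀ {f g} → f ∈ flags h → g ∈ flags h → flag-point f ∈ℓ flag-line g → f ≡ g
    flags-induced {a , s} {b , t} f∈ g∈ x∈ℓ with flag-bounds h f∈ | flag-bounds h g∈
    ... | a<X , s-good , s<N | b<X , t-good , t<N = flags≡ (good-rigid h {a} {b} {+ s} {+ t} a<X b<X s-good t-good (begin
        + s + sq (+ a - + b)        ≡⟨ cong (λ z → + s + z) (sq-distance a b) ⟩
        + (s ℕ.+ distance² a b)     ≡⟨ cong +_ s+δ≡t ⟩
        + t                         ≡⟨ lem₁ (+ t) (+ a) ⟩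
        + t + sq (+ a - + a)        ∎)) s+δ≡t
      where
      open ≡-Reasoning
      lem₁ : ∀ t a → t ≡ t + (a - a) * (a - a)
      lem₁ = solve-∀
      lem₂ : ∀ a b s t → s + (a - b) * (a - b) - t ≡ (a * a + s) - (+ 2 * b * a - b * b + t)
      lem₂ = solve-∀
      on-line : + a * + a + + s ≋ + 2 * + b * + a - + b * + b + + t
      on-line = ≋-trans (≋-sym (residue-≋ (+ a * + a + + s))) (≋-trans (affine∈flag-line⇒ {a = b} {t} x∈ℓ)
        (+-≋ (+-≋ (*-≋ (≋-refl {+ 2 * + b}) (residue-≋ (+ a))) (≋-refl { - (+ b * + b)})) (≋-refl {+ t})))
      s+δ≡t : s ℕ.+ distance² a b ≡ t
      s+δ≡t = ≈⇒≡ (ℕ.<-≤-trans (ℕ.+-mono-< s<N (distance²<289^h h a<X b<X)) N+N≤q)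
        (ℕ.<-≤-trans t<N N≤q)
        (≋-shift (trans (cong (λ z → + s + z - + t) (sym (sq-distance a b))) (lem₂ (+ a) (+ b) (+ s) (+ t))) on-line)
      flags≡ : a ≡ b → s ℕ.+ distance² a b ≡ t → (a , s) ≡ (b , t)
      -- `distance² a a` is 0, read off from `lem₁` with t = 0.
      flags≡ refl eq = cong (a ,_) (trans (sym (ℕ.+-identityʳ s))
        (trans (cong (s ℕ.+_) (sym (ℤ.+-injective (trans (sym (sq-distance a a)) (sym (trans (lem₁ (+ 0) (+ a)) (ℤ.+-identityˡ _))))))) eq))

    -- A line of slope 2a is y = 2ax - a² + d with d = a² - u c₀. Completing squares, its point of
    -- abscissa x lies on the line of (b , s) iff d + (x - b)² ≡ s + (x - a)².
    affine-blocked : ∀ c₀ c₁ c₂ c≢0 u a x → u * ⟦ c₂ ⟧ ≋ + 1 → - (u * ⟦ c₁ ⟧) ≋ + 2 * + a →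
      (∀ {b s} → (b , s) ∈ flags h → (+ a * + a - u * ⟦ c₀ ⟧) + sq (+ x - + b) ≋ + s + sq (+ x - + a) → x ≡ b) →
      ∃ λ p → p ∈ℓ ((c₀ ∷ c₁ ∷ c₂ ∷ []) , c≢0) × Admissible flag-point flag-line (flags h) p
    affine-blocked c₀ c₁ c₂ c≢0 u a x uc₂≋1 -uc₁≋2a separated = affine (residue (+ x)) y , on-line , admissible
      where
      y : 𝔽
      y = residue (+ 2 * + a * + x - u * ⟦ c₀ ⟧)
      y≋ : ⟦ y ⟧ ≋ - (u * ⟦ c₁ ⟧) * + x - u * ⟦ c₀ ⟧
      y≋ = ≋-trans (residue-≋ (+ 2 * + a * + x - u * ⟦ c₀ ⟧)) (+-≋ (*-≋ (≋-sym -uc₁≋2a) (≋-refl {+ x})) (≋-refl { - (u * ⟦ c₀ ⟧)}))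
      on-line : affine (residue (+ x)) y ∈ℓ ((c₀ ∷ c₁ ∷ c₂ ∷ []) , c≢0)
      on-line = ≋0⇒on (vector (affine (residue (+ x)) y)) (c₀ ∷ c₁ ∷ c₂ ∷ []) (≋-trans
        (+-≋ (+-≋ (≡⇒≋ (cong (_* ⟦ c₀ ⟧) ⟦1#⟧)) (*-≋ (residue-≋ (+ x)) (≋-refl {⟦ c₁ ⟧}))) (*-≋ y≋ (≋-refl {⟦ c₂ ⟧})))
        (≋-shift (lem u ⟦ c₀ ⟧ ⟦ c₁ ⟧ ⟦ c₂ ⟧ (+ x)) (*-≋ (≋-refl { - (⟦ c₀ ⟧ + + x * ⟦ c₁ ⟧)}) uc₂≋1)))
        where
        lem : ∀ u c₀ c₁ c₂ x → + 1 * c₀ + x * c₁ + (- (u * c₁) * x - u * c₀) * c₂ - + 0 ≡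
          - (c₀ + x * c₁) * (u * c₂) - - (c₀ + x * c₁) * + 1
        lem = solve-∀
      admissible : Admissible flag-point flag-line (flags h) (affine (residue (+ x)) y)
      admissible {b , s} f∈ x∈ℓ = meets-flag-point {f = b , s}
        (separated f∈ (≋-shift (lem (u * ⟦ c₀ ⟧) (+ a) (+ b) (+ x) (+ s)) y-on)) x∈ℓ
        where
        y-on : + 2 * + a * + x - u * ⟦ c₀ ⟧ ≋ + 2 * + b * + x - + b * + b + + s
        y-on = ≋-trans (≋-sym (residue-≋ (+ 2 * + a * + x - u * ⟦ c₀ ⟧))) (≋-trans (affine∈flag-line⇒ {a = b} {s} x∈ℓ)
          (+-≋ (+-≋ (*-≋ (≋-refl {+ 2 * + b}) (residue-≋ (+ x))) (≋-refl { - (+ b * + b)})) (≋-refl {+ s})))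
        lem : ∀ w a b x s → (a * a - w) + (x - b) * (x - b) - (s + (x - a) * (x - a)) ≡
          (+ 2 * a * x - w) - (+ 2 * b * x - b * b + s)
        lem = solve-∀

    blocked : ∀ ℓ → ∃ λ p → p ∈ℓ ℓ × Admissible flag-point flag-line (flags h) p
    blocked ((c₀ ∷ c₁ ∷ c₂ ∷ []) , c≢0) with at-infinity c₀ c₁ c₂ c≢0
    ... | inj₁ vertical∈ = vertical , vertical∈ , λ {f} _ x∈ℓ → contradiction x∈ℓ (vertical∉flag-line f)
    ... | inj₂ (u , uc₂≋1 , direction∈) = by-slope (Any.any? (λ a → m ≟ residue (+ 2 * + a)) (upTo X))
      where
      m : 𝔽
      m = residue (- (u * ⟦ c₁ ⟧))
      by-slope : Dec (Any (λ a → m ≡ residue (+ 2 * + a)) (upTo X)) → _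
      -- The line of (b , s) has slope 2b, so a direction not of this form lies on no flag line.
      by-slope (no ∄a) = direction m , direction∈ , λ { {a , s} f∈ x∈ℓ → contradiction
        (lose (∈-upTo⁺ (proj₁ (flag-bounds h f∈)))
          (⟦⟧-injective (≋-trans (direction∈flag-line⇒ {a = a} {s} x∈ℓ) (≋-sym (residue-≋ (+ 2 * + a)))))) ∄a }
      by-slope (yes ∃a) =
        let a , a∈ , m≡2a = find ∃a
            d = + a * + a - u * ⟦ c₀ ⟧
            x , separated = separation d (∈-upTo⁻ a∈)
        in affine-blocked c₀ c₁ c₂ c≢0 u a x uc₂≋1
             (≋-trans (≋-sym (residue-≋ (- (u * ⟦ c₁ ⟧)))) (≋-trans (≡⇒≋ (cong ⟦_⟧ m≡2a)) (residue-≋ (+ 2 * + a))))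
             separated

    minimal-blocking-set : ∃ λ B → MinimalBlocking B × 578 ℕ.^ h ℕ.≤ size B
    minimal-blocking-set =
      let R , R! , blocks , tangent , flags≤R = minimal-blocking flag-point flag-line (flags h) normals ∈-normals
            (flags-unique h) flags-induced (λ {f} _ → flag-incident f) blocked
      in pointSet (map point R) (points-unique R!) , tangent⇒minimal R! blocks tangent ,
         subst₂ ℕ._≤_ (length-flags h) (sym (length-map point R)) flags≤R

  -- Serves the primes below 3, where no scale h fits. Without flags every point is admissible, and
  -- a blocking set is nonempty because it meets some line.
  nonempty-minimal-blocking-set : ∃ λ B → MinimalBlocking B × 1 ℕ.≤ size B
  nonempty-minimal-blocking-set =
    let R , R! , blocks , tangent , _ = minimal-blocking flag-point flag-line [] normals ∈-normals [] (λ ()) (λ ()) meets-infinity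
    in pointSet (map point R) (points-unique R!) , tangent⇒minimal R! blocks tangent ,
       subst (1 ℕ.≤_) (sym (length-map point R)) (nonempty {ℓ = flag-line (0 , 0)} (blocks (flag-line (0 , 0))))
    where
    nonempty : ∀ {R ℓ} → Any (_∈ℓ ℓ) R → 1 ℕ.≤ length R
    nonempty (here _)  = ℕ.s≤s ℕ.z≤n
    nonempty (there _) = ℕ.s≤s ℕ.z≤n
    meets-infinity : ∀ ℓ → ∃ λ x → x ∈ℓ ℓ × Admissible flag-point flag-line [] x
    meets-infinity ((c₀ ∷ c₁ ∷ c₂ ∷ []) , c≢0) with at-infinity c₀ c₁ c₂ c≢0
    ... | inj₁ vertical∈            = vertical , vertical∈ , λ ()
    ... | inj₂ (u , _ , direction∈) = direction (residue (- (u * ⟦ c₁ ⟧))) , direction∈ , λ ()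

-- Choice of the scale and the final estimate.

scale : ∀ q → q ℕ.< 3 ⊎ ∃ λ h → 3 ℕ.* 289 ℕ.^ h ℕ.≤ q × q ℕ.≤ 867 ℕ.* 289 ℕ.^ h
scale zero = inj₁ (ℕ.s≤s ℕ.z≤n)
scale (suc q) with scale q
... | inj₁ q<3 with suc q ℕ.<? 3
...   | yes q<3′ = inj₁ q<3′
...   | no  q≮3  = inj₂ (0 , ℕ.≮⇒≥ q≮3 , ℕ.≤-trans q<3 (ℕ.m≤m+n 3 864))
scale (suc q) | inj₂ (h , lower , upper) with suc q ℕ.≤? 867 ℕ.* 289 ℕ.^ h
... | yes upper′ = inj₂ (h , ℕ.m≤n⇒m≤1+n lower , upper′)
-- The upper limit 867 · 289^h equals 3 · 289^(h+1), so passing it is exactly what permits the next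
-- scale.
... | no  ¬upper = inj₂ (suc h ,
  ℕ.≤-trans (ℕ.≤-reflexive (sym (ℕ.*-assoc 3 289 (289 ℕ.^ h)))) (ℕ.<⇒≤ (ℕ.≰⇒> ¬upper)) ,
  ℕ.≤-trans (ℕ.s≤s upper) (ℕ.*-monoʳ-< 867 (ℕ.^-monoʳ-< 289 (ℕ.s≤s (ℕ.s≤s ℕ.z≤n)) (ℕ.n<1+n h))))

-- The constant 2601 = 3 · 867 suffices since 867 ≤ 3^9.
growth : ∀ h {q n} → q ℕ.≤ 867 ℕ.* 289 ℕ.^ h → 578 ℕ.^ h ℕ.≤ n → q ℕ.^ 10 ℕ.≤ (2601 ℕ.* n) ℕ.^ 9
growth h {q} {n} q≤ ≤n = begin
  q ℕ.^ 10                                  ≤⟨ ℕ.^-monoˡ-≤ 10 q≤ ⟩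
  (867 ℕ.* 289 ℕ.^ h) ℕ.^ 10                ≡⟨ ^-distribʳ-* 10 867 (289 ℕ.^ h) ⟩
  867 ℕ.^ 10 ℕ.* (289 ℕ.^ h) ℕ.^ 10         ≤⟨ ℕ.*-mono-≤ (from-yes (867 ℕ.^ 10 ℕ.≤? 2601 ℕ.^ 9)) powers ⟩
  2601 ℕ.^ 9 ℕ.* (578 ℕ.^ h) ℕ.^ 9          ≡⟨ ^-distribʳ-* 9 2601 (578 ℕ.^ h) ⟨
  (2601 ℕ.* 578 ℕ.^ h) ℕ.^ 9                ≤⟨ ℕ.^-monoˡ-≤ 9 (ℕ.*-monoʳ-≤ 2601 ≤n) ⟩
  (2601 ℕ.* n) ℕ.^ 9                        ∎
  where
  open ℕ.≤-Reasoning
  powers : (289 ℕ.^ h) ℕ.^ 10 ℕ.≤ (578 ℕ.^ h) ℕ.^ 9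
  powers = begin
    (289 ℕ.^ h) ℕ.^ 10   ≡⟨ ^-^-comm 289 h 10 ⟩
    -- As 578 = 2 · 289, the numerical check amounts to 289 ≤ 2^9; this is the source of the
    -- exponent 1/9.
    (289 ℕ.^ 10) ℕ.^ h   ≤⟨ ℕ.^-monoˡ-≤ h (from-yes (289 ℕ.^ 10 ℕ.≤? 578 ℕ.^ 9)) ⟩
    (578 ℕ.^ 9) ℕ.^ h    ≡⟨ ^-^-comm 578 9 h ⟩
    (578 ℕ.^ h) ℕ.^ 9    ∎
    where
    ^-^-comm : ∀ m j k → (m ℕ.^ j) ℕ.^ k ≡ (m ℕ.^ k) ℕ.^ j
    ^-^-comm m j k = trans (ℕ.^-*-assoc m j k) (trans (cong (m ℕ.^_) (ℕ.*-comm j k)) (sym (ℕ.^-*-assoc m k j)))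

-- Lets the bound be proved for literal numerators and denominators, which are then matched with
-- those of κ and c.
≥-intro : ∀ {n q} κ c {s t a b} → ∣ ℚ.↥ κ ∣ ≡ s → ℚ.↧ₙ κ ≡ t → ∣ ℚ.↥ c ∣ ≡ a → ℚ.↧ₙ c ≡ b →
  s ℕ.^ b ℕ.* q ℕ.^ (b ℕ.+ a) ℕ.≤ (t ℕ.* n) ℕ.^ b → n ≥ κ · q ^1+ c
≥-intro κ c refl refl refl refl bound = bound

≥-mono : ∀ {m n} κ c {q} → m ℕ.≤ n → m ≥ κ · q ^1+ c → n ≥ κ · q ^1+ c
≥-mono κ c m≤n bound = ℕ.≤-trans bound (ℕ.^-monoˡ-≤ (ℚ.↧ₙ c) (ℕ.*-monoʳ-≤ (ℚ.↧ₙ κ) m≤n))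

exponent constant : ℚ
exponent = + 1 ℚ./ 9
constant = + 1 ℚ./ 2601

growth⇒≥ : ∀ h {q n} → q ℕ.≤ 867 ℕ.* 289 ℕ.^ h → 578 ℕ.^ h ℕ.≤ n → n ≥ constant · q ^1+ exponent
growth⇒≥ h {q} {n} q≤ ≤n = ≥-intro {n} {q} constant exponent refl refl refl refl
  (ℕ.≤-trans (ℕ.≤-reflexive (ℕ.*-identityˡ (q ℕ.^ 10))) (growth h q≤ ≤n))

large-minimal-blocking-set : ∀ q (q-prime : Prime q) → let open PG2 q q-prime in
  ∃ λ B → MinimalBlocking B × size B ≥ constant · q ^1+ exponent
large-minimal-blocking-set q q-prime = [ small , large ]′ (scale q)
  where
  open PG2 q q-prime
  Large : Set
  Large = ∃ λ B → MinimalBlocking B × size B ≥ constant · q ^1+ exponent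
  small : q ℕ.< 3 → Large
  small q<3 =
    let B , minimal , 1≤B = Plane.nonempty-minimal-blocking-set q q-prime
    -- At h = 0 the estimate asks only for q ≤ 867 and at least one point.
    in B , minimal , growth⇒≥ 0 {q} {size B} (ℕ.≤-trans (ℕ.<⇒≤ q<3) (ℕ.m≤m+n 3 864)) 1≤B
  large : (∃ λ h → 3 ℕ.* 289 ℕ.^ h ℕ.≤ q × q ℕ.≤ 867 ℕ.* 289 ℕ.^ h) → Large
  large (h , lower , upper) =
    let B , minimal , ≤B = Plane.minimal-blocking-set q q-prime h lower
    in B , minimal , growth⇒≥ h {q} {size B} upper ≤B

theorem1p13 : ∃ λ (c : ℚ) → ∃ λ (c′ : ℚ) → 0ℚ < c × 0ℚ < c′ ×
    (∀ (q : ℕ) (q-prime : Prime q) → let open PG2 q q-prime in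
    (∃ λ (B : PointSet) → MinimalBlocking B × size B ≥ c′ · q ^1+ c)
    × (∀ (b : ℕ) → IsB b → b ≥ c′ · q ^1+ c))
theorem1p13 = exponent , constant , ℚ.positive⁻¹ exponent , ℚ.positive⁻¹ constant , λ q q-prime →
  let B , minimal , large = large-minimal-blocking-set q q-prime
  in (B , minimal , large) , λ b (_ , maximal) → ≥-mono {PG2.size B} {b} constant exponent {q} (maximal B minimal) large
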